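{- There exist constants $c>0$ and $c''>0$ such that for every sufficiently large $n$ that is a power of $2$, there is a sub-collection $\mathcal{P}^*\subseteq\mathcal{P}$ with $|\mathcal{P}^*|\ge 2^{c'' n\log n}$ such that for any two distinct $P_1,P_2\in\mathcal{P}^*$, $$\mathrm{disc}(P_1\uplus P_2,\mathcal{R}_2)\ge c\log n .$$
   Context: Logarithms are base 2. $\mathcal{P}$ denotes the collection of all sets of $n$ points drawn from an $n\times n$ grid. $\mathcal{R}_2$ is the set of all axis-parallel rectangles in the plane. For a finite multiset $X$ of points, $\mathrm{disc}(X,\mathcal{R}_2)=\min_{\chi}\max_{R\in\mathcal{R}_2}\bigl|\sum_{p\in X\cap R}\chi(p)\bigr|$, where $\chi$ ranges over all assignments of a color in $\{ -1,+1\}$ to each element of $X$ (elements counted with multiplicity). $P_1\uplus P_2$ denotes the union of $P_1$ and $P_2$ as a multiset (a point lying in both sets appears twice). -}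

module Defs where

open import Data.Nat using (ℕ; zero; suc; _+_; _*_; _≤_; _^_)
open import Data.Integer using (ℤ; +_; -_; ∣_∣) renaming (_+_ to _+ℤ_)
open import Data.Fin using (Fin; zero; suc) renaming (_≤?_ to _≤ᶠ?_)
open import Data.Bool using (Bool; true; false; if_then_else_; _∧_)
open import Data.Product using (_×_; _,_; ∃)
open import Relation.Nullary.Decidable using (⌊_⌋)

Point : ℕ → Set
Point n = Fin n × Fin n

PointSet : ℕ → Set
PointSet n = Point n → Bool

sumℕ : (m : ℕ) → (Fin m → ℕ) → ℕ
sumℕ zero    f = 0
sumℕ (suc m) f = f zero + sumℕ m (λ i → f (suc i))

sumℤ : (m : ℕ) → (Fin m → ℤ) → ℤ
sumℤ zero    f = + 0
sumℤ (suc m) f = f zero +ℤ sumℤ m (λ i → f (suc i))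

card : {n : ℕ} → PointSet n → ℕ
card {n} P = sumℕ n (λ i → sumℕ n (λ j → if P (i , j) then 1 else 0))

-- Traces of axis-parallel rectangles on the grid: products of index
-- intervals [x₁,x₂] × [y₁,y₂] (empty when x₁ > x₂ or y₁ > y₂).
record Rect (n : ℕ) : Set where
  constructor rect
  field
    x₁ x₂ y₁ y₂ : Fin n

inRect : {n : ℕ} → Rect n → Point n → Bool
inRect (rect x₁ x₂ y₁ y₂) (i , j) =
  ⌊ x₁ ≤ᶠ? i ⌋ ∧ ⌊ i ≤ᶠ? x₂ ⌋ ∧ ⌊ y₁ ≤ᶠ? j ⌋ ∧ ⌊ j ≤ᶠ? y₂ ⌋

Coloring : ℕ → Set
Coloring n = Point n → Bool

colorVal : Bool → ℤ
colorVal true  = + 1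
colorVal false = - (+ 1)

contrib : {n : ℕ} → PointSet n → Coloring n → Rect n → Point n → ℤ
contrib P χ R p = if P p ∧ inRect R p then colorVal (χ p) else + 0

-- Signed sum over R of the multiset P₁ ⊎ P₂, where the copy of a point coming
-- from P₁ gets colour χ₁ and the copy coming from P₂ gets colour χ₂.
unionSum : {n : ℕ} → PointSet n → PointSet n → Coloring n → Coloring n → Rect n → ℤ
unionSum {n} P₁ P₂ χ₁ χ₂ R =
  sumℤ n (λ i → sumℤ n (λ j → contrib P₁ χ₁ R (i , j) +ℤ contrib P₂ χ₂ R (i , j)))

-- disc(P₁ ⊎ P₂, R₂) ≥ (a / b) · L, i.e. for every colouring of the multiset
-- some rectangle R has b · |Σ_{R} χ| ≥ a · L  (min_χ max_R |·| ≥ t  unfolded).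
DiscUnionAtLeast : {n : ℕ} → PointSet n → PointSet n → (a b L : ℕ) → Set
DiscUnionAtLeast P₁ P₂ a b L =
  (χ₁ χ₂ : Coloring _) → ∃ λ R → a * L ≤ b * ∣ unionSum P₁ P₂ χ₁ χ₂ R ∣

{-# OPTIONS --safe #-}

-- Halász's Riesz product method, arranged so that no error terms arise.
--
-- With x and y written in base 16, a tree of bits determines a net of 16^K points:
-- reading x from its least and y from its most significant digit, the point
-- with digit (a″,a′) of x gets the digit (y′,y″) = (a′, σ_b a″) of y, where the
-- bit b belongs to the remaining digits of x and the previous digits of y, and
-- σ exchanges 1 and 3 when b is set.  At every level the cell
-- (remaining digits of x, a″; previous digits of y, y′) thus contains one point
-- of each net.  Let ε = (-1,0,1,0) on base-4 digits, f = ± ε(a′) ε(y″) on the cells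
-- with a″ = y′ = 1 in which the two trees have different bits, and f = 0 elsewhere,
-- and integrate the colour sum D over corners against G = ∏ (1 + f).  In a cell
-- with f ≠ 0 both points have ε(a′) = ε(y″) = 0, so every product of two or more
-- factors f integrates to zero against the corners at the points, while exactly
-- one of the two points contributes to the linear term, by a fixed amount.  Hence
-- ∫ (G - 1) D is a multiple of the Hamming distance of the trees, and max |D| is at
-- least a multiple of that distance divided by 16^K.  The trees are taken from a
-- code of linear distance and rate; the net fills the corner of side
-- 16^K > 2^k / 16 of the grid, and the remaining points go to the diagonal.

module Submission where

open import Defs
open import Data.Nat as ℕ using (ℕ; zero; suc; NonZero)
import Data.Nat.Properties as ℕP
open import Data.Nat.DivMod using (_/_; _%_; _mod_; m%n<n; m≡m%n+[m/n]*n; [m+kn]%n≡m%n; m<n⇒m%n≡m; +-distrib-/-∣ˡ; m*n/n≡m; m<n⇒m/n≡0; m/n*n≤m; /-monoˡ-≤)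
open import Data.Nat.Divisibility using (n∣m*n)
import Data.Nat.Tactic.RingSolver as ℕSolver
open import Data.Bool using (Bool; true; false; if_then_else_; _∧_; T)
open import Data.Fin using (Fin; zero; suc; toℕ; fromℕ<)
open import Data.Fin.Properties using (toℕ<n; toℕ-injective; toℕ-fromℕ<; any?; _≟_)
open import Data.List using (List; []; _∷_; _++_; map; cartesianProduct; length; lookup)
open import Data.List.Properties using (length-++; length-map)
open import Data.Product using (_×_; _,_; proj₁; proj₂; ∃; Σ)
open import Data.Unit using (⊤; tt)
open import Function using (_∘_)
open import Relation.Binary.Definitions using (tri<; tri≈; tri>)
open import Relation.Binary.PropositionalEquality using (_≡_; _≢_; refl; sym; trans; cong; cong₂; subst; subst₂; module ≡-Reasoning)
open import Relation.Nullary using (¬_; yes; no; contradiction; does)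
open import Relation.Nullary.Decidable using (isYes≗does; dec-true; dec-false)

module Nets where
  open import Data.Integer using (ℤ; +_; -_; -[1+_]; 0ℤ; 1ℤ; _+_; _*_; _-_; _≤_; _^_; +≤+; -≤+; -≤-; +<+; ∣_∣; Positive; nonNegative; positive)
  open import Data.Integer.Properties using (_≤?_; +-identityˡ; +-identityʳ; +-assoc; *-identityˡ; *-identityʳ; *-zeroʳ; *-assoc; *-comm; *-distribˡ-+; +-mono-≤; +-monoʳ-≤; ≤-refl; ≤-reflexive; ≤-trans; ≤-<-trans; ≰⇒>; i≤j+i; neg-mono-≤; *-cancelˡ-≤-pos; *-monoˡ-≤-nonNeg; pos-+; pos-*; drop‿+≤+; drop‿+<+; module ≤-Reasoning)
  open import Data.Integer.Tactic.RingSolver using (solve-∀)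

  -- Finite sums over lists

  private variable
    A B : Set

  ∑ : List A → (A → ℤ) → ℤ
  ∑ []       f = 0ℤ
  ∑ (x ∷ xs) f = f x + ∑ xs f

  ∑-cong : (xs : List A) {f g : A → ℤ} → (∀ x → f x ≡ g x) → ∑ xs f ≡ ∑ xs g
  ∑-cong []       e = refl
  ∑-cong (x ∷ xs) e = cong₂ _+_ (e x) (∑-cong xs e)

  ∑-zero : (xs : List A) → ∑ xs (λ _ → 0ℤ) ≡ 0ℤ
  ∑-zero []       = refl
  ∑-zero (x ∷ xs) = trans (+-identityˡ _) (∑-zero xs)

  interchange : ∀ a b c d → (a + b) + (c + d) ≡ (a + c) + (b + d)
  interchange = solve-∀

  ∑-+ : (xs : List A) (f g : A → ℤ) → ∑ xs (λ x → f x + g x) ≡ ∑ xs f + ∑ xs g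
  ∑-+ []       f g = refl
  ∑-+ (x ∷ xs) f g = trans (cong (_+_ (f x + g x)) (∑-+ xs f g)) (interchange (f x) (g x) _ _)

  ∑-* : (k : ℤ) (xs : List A) (f : A → ℤ) → ∑ xs (λ x → k * f x) ≡ k * ∑ xs f
  ∑-* k []       f = sym (*-zeroʳ k)
  ∑-* k (x ∷ xs) f = trans (cong (_+_ (k * f x)) (∑-* k xs f)) (sym (*-distribˡ-+ k (f x) _))

  ∑-mono : (xs : List A) {f g : A → ℤ} → (∀ x → f x ≤ g x) → ∑ xs f ≤ ∑ xs g
  ∑-mono []       e = ≤-refl
  ∑-mono (x ∷ xs) e = +-mono-≤ (e x) (∑-mono xs e)

  ∑-swap : (xs : List A) (ys : List B) (f : A → B → ℤ) →
    ∑ xs (λ x → ∑ ys (f x)) ≡ ∑ ys (λ y → ∑ xs (λ x → f x y))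
  ∑-swap []       ys f = sym (∑-zero ys)
  ∑-swap (x ∷ xs) ys f =
    trans (cong (_+_ (∑ ys (f x))) (∑-swap xs ys f)) (sym (∑-+ ys (f x) _))

  ∑-++ : (xs ys : List A) (f : A → ℤ) → ∑ (xs ++ ys) f ≡ ∑ xs f + ∑ ys f
  ∑-++ []       ys f = sym (+-identityˡ _)
  ∑-++ (x ∷ xs) ys f = trans (cong (_+_ (f x)) (∑-++ xs ys f)) (sym (+-assoc (f x) _ _))

  ∑-map : (h : A → B) (xs : List A) (f : B → ℤ) → ∑ (map h xs) f ≡ ∑ xs (λ x → f (h x))
  ∑-map h []       f = refl
  ∑-map h (x ∷ xs) f = cong (_+_ (f (h x))) (∑-map h xs f)

  ∑-× : (xs : List A) (ys : List B) (f : A × B → ℤ) →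
    ∑ (cartesianProduct xs ys) f ≡ ∑ xs (λ x → ∑ ys (λ y → f (x , y)))
  ∑-× []       ys f = refl
  ∑-× (x ∷ xs) ys f = trans (∑-++ (map (x ,_) ys) _ f)
    (cong₂ _+_ (∑-map (x ,_) ys f) (∑-× xs ys f))

  -- Base-4 digits and sums over one digit

  Digit : Set
  Digit = Fin 4

  pattern d0 = zero
  pattern d1 = suc zero
  pattern d2 = suc (suc zero)
  pattern d3 = suc (suc (suc zero))

  -- Opaque, so that sums over the digits stay folded during unification.
  opaque
    digits : List Digit
    digits = d0 ∷ d1 ∷ d2 ∷ d3 ∷ []

  ind : Bool → ℤ
  ind true  = 1ℤ
  ind false = 0ℤ

  lt eq : ℕ → ℕ → ℤ
  lt m n = ind (m ℕ.<ᵇ n)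
  eq m n = ind (m ℕ.≡ᵇ n)

  ltᵈ eqᵈ : Digit → Digit → ℤ
  ltᵈ p y = lt (toℕ p) (toℕ y)
  eqᵈ p y = eq (toℕ p) (toℕ y)

  data Trit : Set where
    neg nil pos : Trit

  ⟦_⟧ : Trit → ℤ
  ⟦ neg ⟧ = - 1ℤ
  ⟦ nil ⟧ = 0ℤ
  ⟦ pos ⟧ = 1ℤ

  εᵗ : Digit → Trit
  εᵗ d0 = neg
  εᵗ d1 = nil
  εᵗ d2 = pos
  εᵗ d3 = nil

  ε : Digit → ℤ
  ε a = ⟦ εᵗ a ⟧

  -- On `d0`, `d1`, `d2`, `d3` the values are (1,1,0,0) for `τ` and (3,2,1,0) for `gt`; hence
  -- `τ + ε` is (0,1,1,0).
  τ gt : Digit → ℤ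
  τ p  = ∑ digits (λ y → ltᵈ p y * ε y)
  gt p = ∑ digits (λ y → ltᵈ p y)

  opaque
    unfolding digits

    eqᵈ-select : ∀ a (f : Digit → ℤ) → ∑ digits (λ b → eqᵈ a b * f b) ≡ f a
    eqᵈ-select d0 f = pick (f d0) (f d1) (f d2) (f d3)
      where
      pick : ∀ w x y z → 1ℤ * w + (0ℤ * x + (0ℤ * y + (0ℤ * z + 0ℤ))) ≡ w
      pick = solve-∀
    eqᵈ-select d1 f = pick (f d0) (f d1) (f d2) (f d3)
      where
      pick : ∀ w x y z → 0ℤ * w + (1ℤ * x + (0ℤ * y + (0ℤ * z + 0ℤ))) ≡ x
      pick = solve-∀
    eqᵈ-select d2 f = pick (f d0) (f d1) (f d2) (f d3)
      where
      pick : ∀ w x y z → 0ℤ * w + (0ℤ * x + (1ℤ * y + (0ℤ * z + 0ℤ))) ≡ y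
      pick = solve-∀
    eqᵈ-select d3 f = pick (f d0) (f d1) (f d2) (f d3)
      where
      pick : ∀ w x y z → 0ℤ * w + (0ℤ * x + (0ℤ * y + (1ℤ * z + 0ℤ))) ≡ z
      pick = solve-∀

    digits-count : ∑ digits (λ _ → 1ℤ) ≡ + 4
    digits-count = refl

    ε-sum : ∑ digits (λ b → 1ℤ * ε b) ≡ 0ℤ
    ε-sum = refl

  affine-sum : (xs : List A) (f g : A → ℤ) (Z κ : ℤ) →
    ∑ xs (λ b → f b * (Z + g b * κ)) ≡ Z * ∑ xs f + κ * ∑ xs (λ b → f b * g b)
  affine-sum xs f g Z κ = trans (∑-cong xs (λ b → expand (f b) (g b) Z κ))
    (trans (∑-+ xs _ _) (cong₂ _+_ (∑-* Z xs f) (∑-* κ xs _)))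
    where
    expand : ∀ f g Z κ → f * (Z + g * κ) ≡ Z * f + κ * (f * g)
    expand = solve-∀

  inner-sum : ∀ a l q N R Z κ →
    ∑ digits (λ b → (l + q * (ltᵈ a b * N + eqᵈ a b * R)) * (Z + ε b * κ))
      ≡ + 4 * (l * Z) + q * ((gt a * N + R) * Z + (τ a * N + ε a * R) * κ)
  inner-sum a l q N R Z κ = begin
    _ ≡⟨ ∑-cong digits (λ b → expand l q (ltᵈ a b) (eqᵈ a b) N R (Z + ε b * κ)) ⟩
    ∑ digits (λ b → l * (1ℤ * (Z + ε b * κ))
      + (q * N * (ltᵈ a b * (Z + ε b * κ)) + q * R * (eqᵈ a b * (Z + ε b * κ))))
      ≡⟨ trans (∑-+ digits _ _) (cong₂ _+_ (∑-* l digits _)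
           (trans (∑-+ digits _ _) (cong₂ _+_ (∑-* (q * N) digits _) (∑-* (q * R) digits _)))) ⟩
    _ ≡⟨ cong₂ _+_ (cong (l *_)
        (trans (affine-sum digits (λ _ → 1ℤ) ε Z κ) (cong₂ (λ u v → Z * u + κ * v) digits-count ε-sum)))
           (cong₂ _+_ (cong (q * N *_) (affine-sum digits (ltᵈ a) ε Z κ))
                      (cong (q * R *_) (eqᵈ-select a (λ b → Z + ε b * κ)))) ⟩
    l * (Z * + 4 + κ * 0ℤ) + (q * N * (Z * gt a + κ * τ a) + q * R * (Z + ε a * κ))
      ≡⟨ collect l q N R Z κ (gt a) (τ a) (ε a) ⟩
    _ ∎
    where
    open ≡-Reasoning
    expand : ∀ l q t e N R X →
      (l + q * (t * N + e * R)) * X ≡ l * (1ℤ * X) + (q * N * (t * X) + q * R * (e * X))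
    expand = solve-∀
    collect : ∀ l q N R Z κ g t e →
      l * (Z * + 4 + κ * 0ℤ) + (q * N * (Z * g + κ * t) + q * R * (Z + e * κ))
        ≡ + 4 * (l * Z) + q * ((g * N + R) * Z + (t * N + e * R) * κ)
    collect = solve-∀

  gt-sum : ∀ a l q N Z →
    ∑ digits (λ b → + 4 * ((l + q * (ltᵈ a b * N)) * Z)) ≡ + 16 * (l * Z) + q * ((+ 4 * gt a * N) * Z)
  gt-sum a l q N Z = begin
    _ ≡⟨ ∑-cong digits (λ b → expand l q (ltᵈ a b) N Z) ⟩
    ∑ digits (λ b → + 4 * (l * Z) * 1ℤ + + 4 * q * N * Z * ltᵈ a b)
      ≡⟨ trans (∑-+ digits _ _)
          (cong₂ _+_ (trans (∑-* (+ 4 * (l * Z)) digits (λ _ → 1ℤ)) (cong (+ 4 * (l * Z) *_) digits-count))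
              (∑-* (+ 4 * q * N * Z) digits (ltᵈ a))) ⟩
    + 4 * (l * Z) * + 4 + + 4 * q * N * Z * gt a
      ≡⟨ collect l q N Z (gt a) ⟩
    _ ∎
    where
    open ≡-Reasoning
    expand : ∀ l q t N Z → + 4 * ((l + q * (t * N)) * Z) ≡ + 4 * (l * Z) * 1ℤ + + 4 * q * N * Z * t
    expand = solve-∀
    collect : ∀ l q N Z g → + 4 * (l * Z) * + 4 + + 4 * q * N * Z * g ≡ + 16 * (l * Z) + q *
        ((+ 4 * g * N) * Z)
    collect = solve-∀

  -- The number of base-16 digits exceeding the one with base-4 digits `p′`, `p″`.
  above : Digit → Digit → ℤ
  above p′ p″ = + 4 * gt p′ + gt p″

  -- For y′ other than `p′` the weight does not depend on y″, and `ε` sums to zero over y″; so `κ`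
  -- survives only at `p′`. This one lexicographic computation serves both coordinates: y with
  -- `N = pw K` in `tailSum-suc`, and x with `N = R = 1` in `cornerMass-suc`.
  digit-sum : ∀ p′ p″ l q N R Z (κ : Digit → ℤ) →
    ∑ digits (λ y′ → ∑ digits (λ y″ →
      (l + q * (ltᵈ p′ y′ * N + eqᵈ p′ y′ * (ltᵈ p″ y″ * N + eqᵈ p″ y″ * R))) * (Z + ε y″ * κ y′)))
      ≡ + 16 * (l * Z) + q * ((above p′ p″ * N + R) * Z + (τ p″ * N + ε p″ * R) * κ p′)
  digit-sum p′ p″ l q N R Z κ = begin
    _ ≡⟨ ∑-cong digits (λ y′ → trans
           (∑-cong digits (λ y″ → cong (_* (Z + ε y″ * κ y′)) (regroup l q (ltᵈ p′ y′) (eqᵈ p′ y′) N _)))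
           (trans (inner-sum p″ (l + q * (ltᵈ p′ y′ * N)) (q * eqᵈ p′ y′) N R Z (κ y′))
             (shift (+ 4 * ((l + q * (ltᵈ p′ y′ * N)) * Z)) q (eqᵈ p′ y′)
               ((gt p″ * N + R) * Z + (τ p″ * N + ε p″ * R) * κ y′)))) ⟩
    ∑ digits (λ y′ → + 4 * ((l + q * (ltᵈ p′ y′ * N)) * Z) + eqᵈ p′ y′ * rest y′)
      ≡⟨ ∑-+ digits _ _ ⟩
    ∑ digits (λ y′ → + 4 * ((l + q * (ltᵈ p′ y′ * N)) * Z)) + ∑ digits (λ y′ → eqᵈ p′ y′ * rest y′)
      ≡⟨ cong₂ _+_ (gt-sum p′ l q N Z) (eqᵈ-select p′ rest) ⟩
    + 16 * (l * Z) + q * ((+ 4 * gt p′ * N) * Z) + rest p′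
      ≡⟨ collect l q N R Z (gt p′) (gt p″) (τ p″ * N + ε p″ * R) (κ p′) ⟩
    _ ∎
    where
    open ≡-Reasoning
    rest : Digit → ℤ
    rest y′ = q * ((gt p″ * N + R) * Z + (τ p″ * N + ε p″ * R) * κ y′)
    regroup : ∀ l q a b N X → l + q * (a * N + b * X) ≡ (l + q * (a * N)) + (q * b) * X
    regroup = solve-∀
    shift : ∀ Y q b X → Y + (q * b) * X ≡ Y + b * (q * X)
    shift = solve-∀
    collect : ∀ l q N R Z g h E k →
      + 16 * (l * Z) + q * ((+ 4 * g * N) * Z) + q * ((h * N + R) * Z + E * k)
        ≡ + 16 * (l * Z) + q * (((+ 4 * g + h) * N + R) * Z + E * k)
    collect = solve-∀

  -- Both coordinates are written in base 16, each digit as two base-4 digits.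
  -- In (u , a″ , a′) : X (suc K) the digit a′ is the least significant one; in
  -- (y′ , y″ , v) : Y (suc K) the digit y′ is the most significant one.
  X Y : ℕ → Set
  X zero    = ⊤
  X (suc K) = X K × Digit × Digit
  Y zero    = ⊤
  Y (suc K) = Digit × Digit × Y K

  allX : ∀ K → List (X K)
  allX zero    = tt ∷ []
  allX (suc K) = cartesianProduct (allX K) (cartesianProduct digits digits)

  allY : ∀ K → List (Y K)
  allY zero    = tt ∷ []
  allY (suc K) = cartesianProduct digits (cartesianProduct digits (allY K))

  ∑X-suc : ∀ K (f : X (suc K) → ℤ) → ∑ (allX (suc K)) f ≡
    ∑ (allX K) (λ u → ∑ digits (λ a″ → ∑ digits (λ a′ → f (u , a″ , a′))))
  ∑X-suc K f = trans (∑-× (allX K) _ f) (∑-cong (allX K) (λ u → ∑-× digits digits (λ v → f (u , v))))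

  ∑Y-suc : ∀ K (f : Y (suc K) → ℤ) → ∑ (allY (suc K)) f ≡
    ∑ digits (λ y′ → ∑ digits (λ y″ → ∑ (allY K) (λ v → f (y′ , y″ , v))))
  ∑Y-suc K f = trans (∑-× digits _ f) (∑-cong digits (λ y′ → ∑-× digits (allY K) (λ v → f (y′ , v))))

  -- The order of digit strings as integer-valued indicators

  ltX eqX leX : ∀ {K} → X K → X K → ℤ
  ltX {zero}  _ _ = 0ℤ
  ltX {suc K} (p , p″ , p′) (u , a″ , a′) =
    ltX p u + eqX p u * (ltᵈ p″ a″ + eqᵈ p″ a″ * ltᵈ p′ a′)
  eqX {zero}  _ _ = 1ℤ
  eqX {suc K} (p , p″ , p′) (u , a″ , a′) = eqX p u * (eqᵈ p″ a″ * eqᵈ p′ a′)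
  leX p u = ltX p u + eqX p u

  leY : ∀ {K} → Y K → Y K → ℤ
  leY {zero}  _ _ = 1ℤ
  leY {suc K} (p′ , p″ , p) (y′ , y″ , y) =
    ltᵈ p′ y′ + eqᵈ p′ y′ * (ltᵈ p″ y″ + eqᵈ p″ y″ * leY p y)

  eqX-select : ∀ K (p : X K) (f : X K → ℤ) → ∑ (allX K) (λ u → eqX p u * f u) ≡ f p
  eqX-select zero    p f = unit (f tt)
    where
    unit : ∀ x → 1ℤ * x + 0ℤ ≡ x
    unit = solve-∀
  eqX-select (suc K) (p , p″ , p′) f = begin
    _ ≡⟨ ∑X-suc K (λ u → eqX (p , p″ , p′) u * f u) ⟩
    _ ≡⟨ ∑-cong (allX K) (λ u → trans
           (∑-cong digits (λ a″ → trans
             (∑-cong digits (λ a′ → reorder (eqX p u) (eqᵈ p″ a″) (eqᵈ p′ a′) (f (u , a″ , a′))))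
             (trans (∑-* (eqX p u * eqᵈ p″ a″) digits (λ a′ → eqᵈ p′ a′ * f (u , a″ , a′)))
               (trans (cong (eqX p u * eqᵈ p″ a″ *_) (eqᵈ-select p′ (λ a′ → f (u , a″ , a′))))
                 (*-assoc (eqX p u) (eqᵈ p″ a″) (f (u , a″ , p′)))))))
           (trans (∑-* (eqX p u) digits (λ a″ → eqᵈ p″ a″ * f (u , a″ , p′)))
             (cong (eqX p u *_) (eqᵈ-select p″ (λ a″ → f (u , a″ , p′)))))) ⟩
    _ ≡⟨ eqX-select K p (λ u → f (u , p″ , p′)) ⟩
    _ ∎
    where
    open ≡-Reasoning
    reorder : ∀ a b c d → (a * (b * c)) * d ≡ (a * b) * (c * d)
    reorder = solve-∀

  eqᵈ-subst : ∀ p y (f : Digit → ℤ) → eqᵈ p y * f y ≡ eqᵈ p y * f p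
  eqᵈ-subst p y f with toℕ p ℕ.≡ᵇ toℕ y in e
  ... | false = refl
  ... | true  = cong (λ z → 1ℤ * f z) (sym (toℕ-injective (ℕP.≡ᵇ⇒≡ _ _ (subst T (sym e) tt))))

  -- Riesz products

  pw : ℕ → ℤ
  pw K = (+ 16) ^ K

  -- One coefficient -1, 0 or 1 for each cell: the previous digits of y are the path taken through
  -- the tree, and the arguments of the coefficient are the remaining digits of x, a″ and y′.
  System : ℕ → Set
  System zero    = ⊤
  System (suc K) = (X K → Digit → Digit → Trit) × (Digit → Digit → System K)

  riesz : ∀ {K} → System K → X K → Y K → ℤ
  riesz {zero}  _ _ _ = 1ℤ
  riesz {suc K} (c , cs) (u , a″ , a′) (y′ , y″ , v) =
    (1ℤ + ε y″ * (ε a′ * ⟦ c u a″ y′ ⟧)) * riesz (cs y′ y″) u v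

  -- Each factor is 1 plus a product of three trits, hence 0, 1 or 2.
  riesz-nonneg : ∀ {K} (c : System K) x y → 0ℤ ≤ riesz c x y
  riesz-nonneg {zero}  _ _ _ = +≤+ ℕ.z≤n
  riesz-nonneg {suc K} (c , cs) (u , a″ , a′) (y′ , y″ , v) =
    nonneg-* (factor (εᵗ y″) (εᵗ a′) (c u a″ y′)) (riesz-nonneg (cs y′ y″) u v)
    where
    nonneg-* : ∀ {i j} → 0ℤ ≤ i → 0ℤ ≤ j → 0ℤ ≤ i * j
    nonneg-* {+ m} {+ n} _ _ = subst (0ℤ ≤_) (pos-* m n) (+≤+ ℕ.z≤n)
    factor : ∀ r s t → 0ℤ ≤ 1ℤ + ⟦ r ⟧ * (⟦ s ⟧ * ⟦ t ⟧)
    factor nil s   t   = +≤+ ℕ.z≤n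
    factor neg nil t   = +≤+ ℕ.z≤n
    factor pos nil t   = +≤+ ℕ.z≤n
    factor neg neg neg = +≤+ ℕ.z≤n
    factor neg neg nil = +≤+ ℕ.z≤n
    factor neg neg pos = +≤+ ℕ.z≤n
    factor neg pos neg = +≤+ ℕ.z≤n
    factor neg pos nil = +≤+ ℕ.z≤n
    factor neg pos pos = +≤+ ℕ.z≤n
    factor pos neg neg = +≤+ ℕ.z≤n
    factor pos neg nil = +≤+ ℕ.z≤n
    factor pos neg pos = +≤+ ℕ.z≤n
    factor pos pos neg = +≤+ ℕ.z≤n
    factor pos pos nil = +≤+ ℕ.z≤n
    factor pos pos pos = +≤+ ℕ.z≤n

  -- Integrating out the less significant digits of y first gives `pw K` in every branch, after
  -- which `ε y″` cancels over y″. So the mass is independent of `c` and `x`.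
  riesz-mass : ∀ K (c : System K) x → ∑ (allY K) (riesz c x) ≡ pw K
  riesz-mass zero    c x = refl
  riesz-mass (suc K) (c , cs) (u , a″ , a′) = begin
    _ ≡⟨ ∑Y-suc K (riesz (c , cs) (u , a″ , a′)) ⟩
    ∑ digits (λ y′ → ∑ digits (λ y″ → ∑ (allY K) (λ v → factor y′ y″ * riesz (cs y′ y″) u v)))
      ≡⟨ ∑-cong digits (λ y′ → trans
           (∑-cong digits (λ y″ → trans (∑-* (factor y′ y″) (allY K) (riesz (cs y′ y″) u))
             (trans (cong (factor y′ y″ *_) (riesz-mass K (cs y′ y″) u)) (*-comm (factor y′ y″) (pw K)))))
           (trans (∑-* (pw K) digits (factor y′))
             (trans (cong (pw K *_) (trans
               (∑-cong digits (λ y″ → sym (*-identityˡ (factor y′ y″))))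
               (trans (affine-sum digits (λ _ → 1ℤ) ε 1ℤ (κ y′))
                 (cong₂ (λ m n → 1ℤ * m + κ y′ * n) digits-count ε-sum))))
               (four (pw K) (κ y′))))) ⟩
    ∑ digits (λ _ → + 4 * pw K * 1ℤ)
      ≡⟨ trans (∑-* (+ 4 * pw K) digits (λ _ → 1ℤ)) (cong (+ 4 * pw K *_) digits-count) ⟩
    + 4 * pw K * + 4 ≡⟨ sixteen (pw K) ⟩
    _ ∎
    where
    open ≡-Reasoning
    κ : Digit → ℤ
    κ y′ = ε a′ * ⟦ c u a″ y′ ⟧
    factor : Digit → Digit → ℤ
    factor y′ y″ = 1ℤ + ε y″ * κ y′
    four : ∀ N k → N * (1ℤ * + 4 + k * 0ℤ) ≡ + 4 * N * 1ℤ
    four = solve-∀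
    sixteen : ∀ N → + 4 * N * + 4 ≡ + 16 * N
    sixteen = solve-∀

  -- Riesz products integrated over corners

  tailSum : ∀ {K} → System K → X K → Y K → ℤ
  tailSum {K} c x p = ∑ (allY K) (λ y → riesz c x y * leY p y)

  -- A branch above the leading digits of `p` counts with its whole mass `pw K`, the branch of `p`
  -- itself with its own tail `R`. The top factor contributes its constant 1 and a term in which the
  -- full branches are weighted by `τ p″` and the branch of `p` by `ε p″`.
  tailSum-suc : ∀ K (c : System (suc K)) u a″ a′ p′ p″ (p : Y K) →
    let R = tailSum (proj₂ c p′ p″) u p in
    tailSum c (u , a″ , a′) (p′ , p″ , p)
      ≡ (above p′ p″ * pw K + R) + (τ p″ * pw K + ε p″ * R) * (ε a′ * ⟦ proj₁ c u a″ p′ ⟧)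
  tailSum-suc K (c , cs) u a″ a′ p′ p″ p = begin
    _ ≡⟨ ∑Y-suc K (λ y → riesz (c , cs) (u , a″ , a′) y * leY (p′ , p″ , p) y) ⟩
    _ ≡⟨ ∑-cong digits (λ y′ → ∑-cong digits (λ y″ → row y′ y″)) ⟩
    ∑ digits (λ y′ → ∑ digits (λ y″ → (0ℤ + 1ℤ * (ltᵈ p′ y′ * pw K + eqᵈ p′ y′ *
      (ltᵈ p″ y″ * pw K + eqᵈ p″ y″ * R p′ p″))) * (1ℤ + ε y″ * κ y′)))
      ≡⟨ digit-sum p′ p″ 0ℤ 1ℤ (pw K) (R p′ p″) 1ℤ κ ⟩
    _ ≡⟨ tidy (above p′ p″ * pw K + R p′ p″) ((τ p″ * pw K + ε p″ * R p′ p″) * κ p′) ⟩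
    _ ∎
    where
    open ≡-Reasoning
    κ : Digit → ℤ
    κ y′ = ε a′ * ⟦ c u a″ y′ ⟧
    R : Digit → Digit → ℤ
    R y′ y″ = tailSum (cs y′ y″) u p
    tidy : ∀ a b → + 16 * (0ℤ * 1ℤ) + 1ℤ * (a * 1ℤ + b) ≡ a + b
    tidy = solve-∀
    expand : ∀ F G s t s′ t′ l → (F * G) * (s + t * (s′ + t′ * l)) ≡ F *
        ((s + t * s′) * G + (t * t′) * (G * l))
    expand = solve-∀
    collect : ∀ F s t s′ t′ N R → F * ((s + t * s′) * N + (t * t′) * R) ≡ F * (s * N + t * (s′ * N + t′ * R))
    collect = solve-∀
    finish : ∀ F z → F * z ≡ (0ℤ + 1ℤ * z) * F
    finish = solve-∀
    row : ∀ y′ y″ →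
      ∑ (allY K) (λ v → (1ℤ + ε y″ * κ y′) * riesz (cs y′ y″) u v * leY (p′ , p″ , p) (y′ , y″ , v))
        ≡ (0ℤ + 1ℤ * (ltᵈ p′ y′ * pw K + eqᵈ p′ y′ *
            (ltᵈ p″ y″ * pw K + eqᵈ p″ y″ * R p′ p″))) * (1ℤ + ε y″ * κ y′)
    row y′ y″ = begin
      _ ≡⟨ ∑-cong (allY K) (λ v → expand F (riesz (cs y′ y″) u v) s t s′ t′ (leY p v)) ⟩
      _ ≡⟨ ∑-* F (allY K) (λ v → (s + t * s′) * riesz (cs y′ y″) u v + (t * t′) *
          (riesz (cs y′ y″) u v * leY p v)) ⟩
      _ ≡⟨ cong (F *_) (trans
          (∑-+ (allY K) (λ v → (s + t * s′) * riesz (cs y′ y″) u v)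
              (λ v → (t * t′) * (riesz (cs y′ y″) u v * leY p v)))
             (cong₂ _+_ (trans (∑-* (s + t * s′) (allY K) (riesz (cs y′ y″) u))
                 (cong ((s + t * s′) *_) (riesz-mass K (cs y′ y″) u)))
                        (∑-* (t * t′) (allY K) (λ v → riesz (cs y′ y″) u v * leY p v)))) ⟩
      F * ((s + t * s′) * pw K + (t * t′) * R y′ y″)
        ≡⟨ collect F s t s′ t′ (pw K) (R y′ y″) ⟩
      F * (s * pw K + t * (s′ * pw K + t′ * R y′ y″))
        -- `eqᵈ` vanishes off `p′` and `p″`, so the branch-dependent `R y′ y″` may be frozen at
        -- `R p′ p″`, as `digit-sum` requires.
        ≡⟨ cong (λ z → F * (s * pw K + z)) (trans
             (cong (λ z → t * (s′ * pw K + z)) (eqᵈ-subst p″ y″ (R y′)))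
             (eqᵈ-subst p′ y′ (λ z → s′ * pw K + t′ * R z p″))) ⟩
      F * (s * pw K + t * (s′ * pw K + t′ * R p′ p″)) ≡⟨ finish F
          (s * pw K + t * (s′ * pw K + t′ * R p′ p″)) ⟩
      _ ∎
      where
      F = 1ℤ + ε y″ * κ y′
      s = ltᵈ p′ y′
      t = eqᵈ p′ y′
      s′ = ltᵈ p″ y″
      t′ = eqᵈ p″ y″

  -- The first equation turns the factors met on the column `x` along the digits of `p` into 1. The
  -- second removes the product of the term of one level with the tail through the deeper levels.
  Compatible : ∀ {K} → System K → X K → Y K → Set
  Compatible {zero}  _ _ _ = ⊤
  Compatible {suc K} (c , cs) (u , a″ , a′) (p′ , p″ , p) =
    ε a′ * ⟦ c u a″ p′ ⟧ ≡ 0ℤ × ε p″ * ⟦ c u a″ p′ ⟧ ≡ 0ℤ × Compatible (cs p′ p″) u p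

  -- The number of `y` at or above `p`, that is, `16 ^ K` minus the number with digits `p`.
  tailCount : ∀ {K} → Y K → ℤ
  tailCount {zero}  _ = 1ℤ
  tailCount {suc K} (p′ , p″ , p) = above p′ p″ * pw K + tailCount p

  tailSum-compatible : ∀ K (c : System K) x p → Compatible c x p → tailSum c x p ≡ tailCount p
  tailSum-compatible zero    c x p _ = refl
  tailSum-compatible (suc K) c (u , a″ , a′) (p′ , p″ , p) (e , _ , rest) = begin
    _ ≡⟨ tailSum-suc K c u a″ a′ p′ p″ p ⟩
    (above p′ p″ * pw K + R) + (τ p″ * pw K + ε p″ * R) * (ε a′ * ⟦ proj₁ c u a″ p′ ⟧)
      ≡⟨ cong (λ z → (above p′ p″ * pw K + R) + (τ p″ * pw K + ε p″ * R) * z) e ⟩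
    (above p′ p″ * pw K + R) + (τ p″ * pw K + ε p″ * R) * 0ℤ
      ≡⟨ drop (above p′ p″ * pw K + R) (τ p″ * pw K + ε p″ * R) ⟩
    above p′ p″ * pw K + R
      ≡⟨ cong (_+_ (above p′ p″ * pw K)) (tailSum-compatible K _ u p rest) ⟩
    _ ∎
    where
    open ≡-Reasoning
    R = tailSum (proj₂ c p′ p″) u p
    drop : ∀ a b → a + b * 0ℤ ≡ a
    drop = solve-∀

  cornerMass : ∀ {K} → System K → X K → Y K → ℤ
  cornerMass {K} c x p = ∑ (allX K) (λ u → leX x u * tailSum c u p)

  -- The corner mass of the constant product 1, in the recursive form that `cornerMass-suc`
  -- produces. It cancels between two systems, so no closed form enters.
  area : ∀ {K} → X K → Y K → ℤ
  area {zero}  _ _ = 1ℤ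
  area {suc K} (x , x″ , x′) (p′ , p″ , p) =
    + 16 * (above p′ p″ * pw K * ∑ (allX K) (leX x)) + + 16 * area x p
      + (above x″ x′ - + 15) * (above p′ p″ * pw K + tailCount p)

  -- The linear part of the Riesz product. From one level to the next, the deeper corner mass and
  -- `pw` are both multiplied by 16, so all levels enter with the same weight and their terms are
  -- added without scaling.
  gain : ∀ {K} → System K → X K → Y K → ℤ
  gain {zero}  _ _ _ = 0ℤ
  gain {suc K} (c , cs) (x , x″ , x′) (p′ , p″ , p) =
    (τ x′ + ε x′) * τ p″ * ⟦ c x x″ p′ ⟧ + gain (cs p′ p″) x p

  cornerMass-suc : ∀ K (c : System (suc K)) x x″ x′ p′ p″ (p : Y K) →
    Compatible c (x , x″ , x′) (p′ , p″ , p) →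
    cornerMass c (x , x″ , x′) (p′ , p″ , p)
      ≡ + 16 * (above p′ p″ * pw K * ∑ (allX K) (leX x)) + + 16 * cornerMass (proj₂ c p′ p″) x p
        + (above x″ x′ - + 15) * (above p′ p″ * pw K + tailCount p)
        + pw K * ((τ x′ + ε x′) * τ p″ * ⟦ proj₁ c x x″ p′ ⟧)
  cornerMass-suc K (c , cs) x x″ x′ p′ p″ p (_ , e , rest) = begin
    _ ≡⟨ ∑X-suc K (λ u → leX (x , x″ , x′) u * tailSum (c , cs) u (p′ , p″ , p)) ⟩
    _ ≡⟨ ∑-cong (allX K) (λ u → trans
           (∑-cong digits (λ a″ → ∑-cong digits (λ a′ → cong₂ _*_
             (reshape (ltX x u) (eqX x u) (ltᵈ x″ a″) (eqᵈ x″ a″) (ltᵈ x′ a′) (eqᵈ x′ a′))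
             (trans (tailSum-suc K (c , cs) u a″ a′ p′ p″ p)
                 (cong (_+_ (Z u)) (reassoc (E u) (ε a′) ⟦ c u a″ p′ ⟧))))))
           -- Over the sixteen digits appended to `u`, the indicator sums to 16 if `u` lies above
           -- `x`, and to `above x″ x′ + 1` if `u` is `x`. Writing the latter as
           -- `16 + (above x″ x′ - 15)` leaves 16 times `leX x u` throughout, plus a correction at
           -- `x` alone.
           (trans (digit-sum x″ x′ (ltX x u) (eqX x u) 1ℤ 1ℤ (Z u) (κ u))
             (split (ltX x u) (eqX x u) (Z u) (above x″ x′) (τ x′) (ε x′) (κ u x″)))) ⟩
    ∑ (allX K) (λ u → + 16 * (leX x u * Z u) + eqX x u * f u)
      ≡⟨ trans (∑-+ (allX K) (λ u → + 16 * (leX x u * Z u)) (λ u → eqX x u * f u)) (cong₂ _+_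
           (trans (∑-* (+ 16) (allX K) (λ u → leX x u * Z u)) (cong (+ 16 *_) leZ))
           (eqX-select K x f)) ⟩
    + 16 * (N * U + W) + f x
      -- The selected column is that of the point, where compatibility determines the tail sum.
      ≡⟨ cong (λ r → + 16 * (N * U + W) + ((above x″ x′ - + 15) * (N + r)
            + (τ x′ + ε x′) * ((τ p″ * pw K + ε p″ * r) * ⟦ c x x″ p′ ⟧)))
           (tailSum-compatible K (cs p′ p″) x p rest) ⟩
    + 16 * (N * U + W) + ((above x″ x′ - + 15) * (N + tailCount p)
            + (τ x′ + ε x′) * ((τ p″ * pw K + ε p″ * tailCount p) * ⟦ c x x″ p′ ⟧))
      ≡⟨ isolate N U W (above x″ x′ - + 15) (N + tailCount p) (τ x′ + ε x′) (τ p″) (pw K) (ε p″)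
          (tailCount p) ⟦ c x x″ p′ ⟧ ⟩
    rhs + (τ x′ + ε x′) * tailCount p * (ε p″ * ⟦ c x x″ p′ ⟧)
      -- What remains is the product of this level's term with the tail through `p`; the second
      -- compatibility equation removes it.
      ≡⟨ trans (cong (λ z → rhs + (τ x′ + ε x′) * tailCount p * z) e)
          (drop rhs ((τ x′ + ε x′) * tailCount p)) ⟩
    rhs ∎
    where
    open ≡-Reasoning
    N = above p′ p″ * pw K
    U = ∑ (allX K) (leX x)
    W = cornerMass (cs p′ p″) x p
    rhs = + 16 * (N * U) + + 16 * W + (above x″ x′ - + 15) * (N + tailCount p)
            + pw K * ((τ x′ + ε x′) * τ p″ * ⟦ c x x″ p′ ⟧)
    R Z E : X K → ℤ
    R u = tailSum (cs p′ p″) u p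
    Z u = N + R u
    E u = τ p″ * pw K + ε p″ * R u
    κ : X K → Digit → ℤ
    κ u a″ = E u * ⟦ c u a″ p′ ⟧
    f : X K → ℤ
    f u = (above x″ x′ - + 15) * Z u + (τ x′ + ε x′) * κ u x″
    reshape : ∀ l q s t s′ t′ → l + q * (s + t * s′) + q * (t * t′)
      ≡ l + q * (s * 1ℤ + t * (s′ * 1ℤ + t′ * 1ℤ))
    reshape = solve-∀
    reassoc : ∀ E e c → E * (e * c) ≡ e * (E * c)
    reassoc = solve-∀
    split : ∀ l q Z A t e k → + 16 * (l * Z) + q * ((A * 1ℤ + 1ℤ) * Z + (t * 1ℤ + e * 1ℤ) * k)
      ≡ + 16 * ((l + q) * Z) + q * ((A - + 15) * Z + (t + e) * k)
    split = solve-∀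
    isolate : ∀ N U W A M t s P e r c →
      + 16 * (N * U + W) + (A * M + t * ((s * P + e * r) * c))
        ≡ + 16 * (N * U) + + 16 * W + A * M + P * (t * s * c) + t * r * (e * c)
    isolate = solve-∀
    drop : ∀ a b → a + b * 0ℤ ≡ a
    drop = solve-∀
    leZ : ∑ (allX K) (λ u → leX x u * Z u) ≡ N * U + W
    leZ = trans (∑-cong (allX K) (λ u → distr (leX x u) N (R u)))
      (trans (∑-+ (allX K) (λ u → N * leX x u) (λ u → leX x u * R u))
        (cong (λ z → z + W) (∑-* N (allX K) (leX x))))
      where
      distr : ∀ l N R → l * (N + R) ≡ N * l + l * R
      distr = solve-∀

  -- The products of two or more factors of the Riesz product do not
  -- contribute: compatibility makes them vanish at the point.
  cornerMass-gain : ∀ K (c : System K) x p → Compatible c x p →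
    + 16 * cornerMass c x p ≡ + 16 * area x p + pw K * gain c x p
  cornerMass-gain zero    c x p _ = refl
  cornerMass-gain (suc K) c (x , x″ , x′) (p′ , p″ , p) comp@(_ , _ , rest) = begin
    _ ≡⟨ cong (+ 16 *_) (cornerMass-suc K c x x″ x′ p′ p″ p comp) ⟩
    + 16 * (a + + 16 * cornerMass (proj₂ c p′ p″) x p + b + pw K * g)
      ≡⟨ cong (λ z → + 16 * (a + z + b + pw K * g)) (cornerMass-gain K (proj₂ c p′ p″) x p rest) ⟩
    + 16 * (a + (+ 16 * area x p + pw K * gain (proj₂ c p′ p″) x p) + b + pw K * g)
      ≡⟨ collect a b (pw K) g (area x p) (gain (proj₂ c p′ p″) x p) ⟩
    _ ∎
    where
    open ≡-Reasoning
    a = + 16 * (above p′ p″ * pw K * ∑ (allX K) (leX x))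
    b = (above x″ x′ - + 15) * (above p′ p″ * pw K + tailCount p)
    g = (τ x′ + ε x′) * τ p″ * ⟦ proj₁ c x x″ p′ ⟧
    collect : ∀ a b P g A G → + 16 * (a + (+ 16 * A + P * G) + b + P * g)
      ≡ + 16 * (a + + 16 * A + b) + + 16 * P * (g + G)
    collect = solve-∀

  -- Trees of bits and their nets

  Tree : ℕ → Set
  Tree zero    = ⊤
  Tree (suc K) = (X K → Bool) × (Digit → Digit → Tree K)

  -- Both exchanged digits are zeros of `ε`, so compatibility survives the exchange; but `τ` is 1 at
  -- `d1` and 0 at `d3`, so the bit switches the linear term of a point on or off.
  σ : Bool → Digit → Digit
  σ true  d1 = d3
  σ true  d3 = d1
  σ true  d0 = d0
  σ true  d2 = d2
  σ false a  = a

  σ-involutive : ∀ b a → σ b (σ b a) ≡ a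
  σ-involutive false a  = refl
  σ-involutive true  d0 = refl
  σ-involutive true  d1 = refl
  σ-involutive true  d2 = refl
  σ-involutive true  d3 = refl

  net : ∀ {K} → Tree K → X K → Y K
  net {zero}  _       _            = tt
  net {suc K} (b , t) (u , a″ , a′) = a′ , σ (b u) a″ , net (t a′ (σ (b u) a″)) u

  diff : Bool → Bool → ℕ
  diff false false = 0
  diff false true  = 1
  diff true  false = 1
  diff true  true  = 0

  treeDist : ∀ {K} → Tree K → Tree K → ℤ
  treeDist {zero}  _ _ = 0ℤ
  treeDist {suc K} (b₁ , t₁) (b₂ , t₂) =
    ∑ (allX K) (λ u → + diff (b₁ u) (b₂ u)) +
    ∑ digits (λ y′ → ∑ digits (λ y″ → treeDist (t₁ y′ y″) (t₂ y′ y″)))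

  -- The Riesz product adapted to two coloured nets

  gate : Digit → Trit → Trit
  gate d0 _ = nil
  gate d1 t = t
  gate d2 _ = nil
  gate d3 _ = nil

  gate-value : ∀ a t → ⟦ gate a t ⟧ ≡ eqᵈ d1 a * ⟦ t ⟧
  gate-value d0 t = refl
  gate-value d1 t = sym (*-identityˡ ⟦ t ⟧)
  gate-value d2 t = refl
  gate-value d3 t = refl

  sgn : Bool → Trit
  sgn true  = pos
  sgn false = neg

  -- When the bits differ exactly one of the two points has y″ = d1, i.e. has
  -- corner weight 1 instead of 0; the system takes its sign.
  pick : Bool → Bool → Bool → Bool → Trit
  pick false false _  _  = nil
  pick false true  s₁ _  = sgn s₁
  pick true  false _  s₂ = sgn s₂
  pick true  true  _  _  = nil

  Signs : ℕ → Set
  Signs K = X K → Bool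

  -- The point continuing in the branch `y′`, `y″` with remaining digits `u` has a′ = `y′` and, `σ`
  -- being an involution, a″ = `σ (b u) y″`.
  subSigns : ∀ {K} → (X K → Bool) → Signs (suc K) → Digit → Digit → Signs K
  subSigns b s y′ y″ u = s (u , σ (b u) y″ , y′)

  -- The support is a″ = y′ = `d1`. Since a′ = y′ on a net, both points of such a cell have the
  -- x-coordinate `(u , d1 , d1)`, and the colours are read there.
  align : ∀ {K} → Tree K → Tree K → Signs K → Signs K → System K
  align {zero}  _ _ _ _ = tt
  align {suc K} (b₁ , t₁) (b₂ , t₂) s₁ s₂ =
    (λ u a″ y′ → gate a″ (gate y′ (pick (b₁ u) (b₂ u) (s₁ (u , d1 , d1)) (s₂ (u , d1 , d1))))) ,
    (λ y′ y″ → align (t₁ y′ y″) (t₂ y′ y″) (subSigns b₁ s₁ y′ y″) (subSigns b₂ s₂ y′ y″))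

  ε-gate : ∀ a″ a′ t → ε a′ * ⟦ gate a″ (gate a′ t) ⟧ ≡ 0ℤ
  ε-gate d0 d0 t = refl
  ε-gate d1 d0 t = refl
  ε-gate d2 d0 t = refl
  ε-gate d3 d0 t = refl
  ε-gate a″ d1 t = refl
  ε-gate d0 d2 t = refl
  ε-gate d1 d2 t = refl
  ε-gate d2 d2 t = refl
  ε-gate d3 d2 t = refl
  ε-gate a″ d3 t = refl

  ε-σ-gate : ∀ b a t → ε (σ b a) * ⟦ gate a t ⟧ ≡ 0ℤ
  ε-σ-gate false d0 t = refl
  ε-σ-gate false d1 t = refl
  ε-σ-gate false d2 t = refl
  ε-σ-gate false d3 t = refl
  ε-σ-gate true  d0 t = refl
  ε-σ-gate true  d1 t = refl
  ε-σ-gate true  d2 t = refl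
  ε-σ-gate true  d3 t = refl

  align-compatible₁ : ∀ K (t₁ t₂ : Tree K) s₁ s₂ x → Compatible (align t₁ t₂ s₁ s₂) x (net t₁ x)
  align-compatible₁ zero    _ _ _ _ _ = tt
  align-compatible₁ (suc K) (b₁ , t₁) (b₂ , t₂) s₁ s₂ (u , a″ , a′) =
    ε-gate a″ a′ _ , ε-σ-gate (b₁ u) a″ _ , align-compatible₁ K _ _ _ _ u

  align-compatible₂ : ∀ K (t₁ t₂ : Tree K) s₁ s₂ x → Compatible (align t₁ t₂ s₁ s₂) x (net t₂ x)
  align-compatible₂ zero    _ _ _ _ _ = tt
  align-compatible₂ (suc K) (b₁ , t₁) (b₂ , t₂) s₁ s₂ (u , a″ , a′) =
    ε-gate a″ a′ _ , ε-σ-gate (b₂ u) a″ _ , align-compatible₂ K _ _ _ _ u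

  opaque
    unfolding digits

    σ-sum : ∀ b (f : Digit → ℤ) → ∑ digits (λ a → f (σ b a)) ≡ ∑ digits f
    σ-sum false f = refl
    σ-sum true  f = exchange (f d0) (f d1) (f d2) (f d3)
      where
      exchange : ∀ w x y z → w + (z + (y + (x + 0ℤ))) ≡ w + (x + (y + (z + 0ℤ)))
      exchange = solve-∀

    -- `τ (σ b d1)` is 1 for an unset bit and 0 for a set one. If the bits differ, the colour of the
    -- point with the unset bit meets the same sign in `pick` and gives 1.
    pick-gain : ∀ b₁ b₂ s₁ s₂ →
      colorVal s₁ * ((τ d1 + ε d1) * τ (σ b₁ d1) * ⟦ pick b₁ b₂ s₁ s₂ ⟧) +
      colorVal s₂ * ((τ d1 + ε d1) * τ (σ b₂ d1) * ⟦ pick b₁ b₂ s₁ s₂ ⟧) ≡ + diff b₁ b₂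
    pick-gain false false true  true  = refl
    pick-gain false false true  false = refl
    pick-gain false false false true  = refl
    pick-gain false false false false = refl
    pick-gain false true  true  true  = refl
    pick-gain false true  true  false = refl
    pick-gain false true  false true  = refl
    pick-gain false true  false false = refl
    pick-gain true  false true  true  = refl
    pick-gain true  false true  false = refl
    pick-gain true  false false true  = refl
    pick-gain true  false false false = refl
    pick-gain true  true  true  true  = refl
    pick-gain true  true  true  false = refl
    pick-gain true  true  false true  = refl
    pick-gain true  true  false false = refl

  netGain : ∀ {K} → System K → Tree K → Signs K → ℤ
  netGain {K} c t s = ∑ (allX K) (λ x → colorVal (s x) * gain c x (net t x))

  -- The points are distributed over the sixteen branches by their leading digits of y: `σ` permutes
  -- the digits, so (a″, a′) may be exchanged for (y″, y′). In the top term both gates leave only a″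
  -- = a′ = `d1`.
  netGain-suc : ∀ K (q : X K → Trit) (cs : Digit → Digit → System K) (b : X K → Bool)
    (t : Digit → Digit → Tree K) (s : Signs (suc K)) →
    netGain ((λ u a″ y′ → gate a″ (gate y′ (q u))) , cs) (b , t) s
      ≡ ∑ (allX K) (λ u → colorVal (s (u , d1 , d1)) * ((τ d1 + ε d1) * τ (σ (b u) d1) * ⟦ q u ⟧))
        + ∑ digits (λ y′ → ∑ digits (λ y″ → netGain (cs y′ y″) (t y′ y″) (subSigns b s y′ y″)))
  netGain-suc K q cs b t s = begin
    _ ≡⟨ ∑X-suc K _ ⟩
    _ ≡⟨ ∑-cong (allX K) (λ u → trans (∑-cong digits (λ a″ → trans (∑-cong digits (λ a′ → term u a″ a′))
           (∑-+ digits (λ a′ → head u a″ a′) (λ a′ → L a′ (σ (b u) a″) u))))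
           (trans (∑-+ digits (λ a″ → ∑ digits (head u a″)) (λ a″ → ∑ digits (λ a′ → L a′ (σ (b u) a″) u)))
             (cong₂ _+_ (heads u) (tails u)))) ⟩
    ∑ (allX K) (λ u → h u d1 d1 * ⟦ q u ⟧ + ∑ digits (λ y′ → ∑ digits (λ y″ → L y′ y″ u)))
      ≡⟨ ∑-+ (allX K) (λ u → h u d1 d1 * ⟦ q u ⟧) _ ⟩
    _ ≡⟨ cong₂ _+_ (∑-cong (allX K)
        (λ u → *-assoc (colorVal (s (u , d1 , d1))) ((τ d1 + ε d1) * τ (σ (b u) d1)) ⟦ q u ⟧))
           (trans (∑-swap (allX K) digits (λ u y′ → ∑ digits (λ y″ → L y′ y″ u)))
             (∑-cong digits (λ y′ → ∑-swap (allX K) digits (λ u y″ → L y′ y″ u)))) ⟩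
    _ ∎
    where
    open ≡-Reasoning
    h head : X K → Digit → Digit → ℤ
    h u a″ a′ = colorVal (s (u , a″ , a′)) * ((τ a′ + ε a′) * τ (σ (b u) a″))
    head u a″ a′ = eqᵈ d1 a″ * (eqᵈ d1 a′ * (h u a″ a′ * ⟦ q u ⟧))
    L : Digit → Digit → X K → ℤ
    L y′ y″ u = colorVal (subSigns b s y′ y″ u) * gain (cs y′ y″) u (net (t y′ y″) u)
    expand : ∀ v w e e′ r g → v * (w * (e * (e′ * r)) + g) ≡ e * (e′ * (v * w * r)) + v * g
    expand = solve-∀
    term : ∀ u a″ a′ → colorVal (s (u , a″ , a′)) *
        gain ((λ u a″ y′ → gate a″ (gate y′ (q u))) , cs) (u , a″ , a′) (net (b , t) (u , a″ , a′))
      ≡ head u a″ a′ + L a′ (σ (b u) a″) u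
    term u a″ a′ = begin
      v * (w * ⟦ gate a″ (gate a′ (q u)) ⟧ + g)
        ≡⟨ cong (λ z → v * (w * z + g)) (trans (gate-value a″ (gate a′ (q u)))
             (cong (eqᵈ d1 a″ *_) (gate-value a′ (q u)))) ⟩
      v * (w * (eqᵈ d1 a″ * (eqᵈ d1 a′ * ⟦ q u ⟧)) + g)
        ≡⟨ expand v w (eqᵈ d1 a″) (eqᵈ d1 a′) ⟦ q u ⟧ g ⟩
      head u a″ a′ + v * g
        -- Replacing a″ by `σ (b u) (σ (b u) a″)` expresses the colour through the digit y″ =
        -- `σ (b u) a″`, as `subSigns` does.
        ≡⟨ cong (λ z → head u a″ a′ + colorVal (s (u , z , a′)) * g) (sym (σ-involutive (b u) a″)) ⟩
      _ ∎
      where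
      v = colorVal (s (u , a″ , a′))
      w = (τ a′ + ε a′) * τ (σ (b u) a″)
      g = gain (cs a′ (σ (b u) a″)) u (net (t a′ (σ (b u) a″)) u)
    heads : ∀ u → ∑ digits (λ a″ → ∑ digits (head u a″)) ≡ h u d1 d1 * ⟦ q u ⟧
    heads u = trans (∑-cong digits
        (λ a″ → trans (∑-* (eqᵈ d1 a″) digits (λ a′ → eqᵈ d1 a′ * (h u a″ a′ * ⟦ q u ⟧)))
        (cong (eqᵈ d1 a″ *_) (eqᵈ-select d1 (λ a′ → h u a″ a′ * ⟦ q u ⟧)))))
      (eqᵈ-select d1 (λ a″ → h u a″ d1 * ⟦ q u ⟧))
    tails : ∀ u → ∑ digits (λ a″ → ∑ digits (λ a′ → L a′ (σ (b u) a″) u)) ≡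
      ∑ digits (λ y′ → ∑ digits (λ y″ → L y′ y″ u))
    tails u = trans (σ-sum (b u) (λ y″ → ∑ digits (λ a′ → L a′ y″ u)))
        (∑-swap digits digits (λ y″ y′ → L y′ y″ u))

  -- The colours drop out, as each nonzero coefficient of `align` carries the colour of the one
  -- point that it detects.
  align-gain : ∀ K (t₁ t₂ : Tree K) s₁ s₂ →
    netGain (align t₁ t₂ s₁ s₂) t₁ s₁ + netGain (align t₁ t₂ s₁ s₂) t₂ s₂ ≡ treeDist t₁ t₂
  align-gain zero    _ _ s₁ s₂ = cong₂ (λ v w → v + 0ℤ + (w + 0ℤ)) (*-zeroʳ (colorVal (s₁ tt)))
      (*-zeroʳ (colorVal (s₂ tt)))
  align-gain (suc K) (b₁ , t₁) (b₂ , t₂) s₁ s₂ = begin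
    _ ≡⟨ cong₂ _+_ (netGain-suc K q cs b₁ t₁ s₁) (netGain-suc K q cs b₂ t₂ s₂) ⟩
    _ ≡⟨ interchange (∑ (allX K) h₁) (∑ digits (λ y′ → ∑ digits (g₁ y′))) (∑ (allX K) h₂)
        (∑ digits (λ y′ → ∑ digits (g₂ y′))) ⟩
    _ ≡⟨ cong₂ _+_
           (trans (sym (∑-+ (allX K) h₁ h₂))
             (∑-cong (allX K) (λ u → pick-gain (b₁ u) (b₂ u) (s₁ (u , d1 , d1)) (s₂ (u , d1 , d1)))))
           (trans (sym (∑-+ digits (λ y′ → ∑ digits (g₁ y′)) (λ y′ → ∑ digits (g₂ y′))))
             (∑-cong digits (λ y′ → trans (sym (∑-+ digits (g₁ y′) (g₂ y′)))
               (∑-cong digits (λ y″ → align-gain K (t₁ y′ y″) (t₂ y′ y″) (subSigns b₁ s₁ y′ y″)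
                   (subSigns b₂ s₂ y′ y″)))))) ⟩
    _ ∎
    where
    open ≡-Reasoning
    q : X K → Trit
    q u = pick (b₁ u) (b₂ u) (s₁ (u , d1 , d1)) (s₂ (u , d1 , d1))
    cs : Digit → Digit → System K
    cs y′ y″ = align (t₁ y′ y″) (t₂ y′ y″) (subSigns b₁ s₁ y′ y″) (subSigns b₂ s₂ y′ y″)
    h₁ h₂ : X K → ℤ
    h₁ u = colorVal (s₁ (u , d1 , d1)) * ((τ d1 + ε d1) * τ (σ (b₁ u) d1) * ⟦ q u ⟧)
    h₂ u = colorVal (s₂ (u , d1 , d1)) * ((τ d1 + ε d1) * τ (σ (b₂ u) d1) * ⟦ q u ⟧)
    g₁ g₂ : Digit → Digit → ℤ
    g₁ y′ y″ = netGain (cs y′ y″) (t₁ y′ y″) (subSigns b₁ s₁ y′ y″)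
    g₂ y′ y″ = netGain (cs y′ y″) (t₂ y′ y″) (subSigns b₂ s₂ y′ y″)

  -- Averages of colour sums over all corners

  pw-pos : ∀ K → pw K ≡ + (16 ℕ.^ K)
  pw-pos zero    = refl
  pw-pos (suc K) = trans (cong (+ 16 *_) (pw-pos K)) (sym (pos-* 16 (16 ℕ.^ K)))

  allX-count : ∀ K → ∑ (allX K) (λ _ → 1ℤ) ≡ pw K
  allX-count zero    = refl
  allX-count (suc K) = begin
    _ ≡⟨ ∑X-suc K (λ _ → 1ℤ) ⟩
    _ ≡⟨ ∑-cong (allX K) (λ u → trans (∑-cong digits (λ _ → trans digits-count (sym (*-identityʳ (+ 4)))))
           (trans (∑-* (+ 4) digits (λ _ → 1ℤ)) (cong (+ 4 *_) digits-count))) ⟩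
    ∑ (allX K) (λ _ → + 16 * 1ℤ) ≡⟨ ∑-* (+ 16) (allX K) (λ _ → 1ℤ) ⟩
    _ ≡⟨ cong (+ 16 *_) (allX-count K) ⟩
    _ ∎
    where open ≡-Reasoning

  cornerSum : ∀ {K} → Tree K → Signs K → X K → Y K → ℤ
  cornerSum {K} t s x y = ∑ (allX K) (λ p → colorVal (s p) * (leX p x * leY (net t p) y))

  -- The integral against the Riesz product, not divided by the total mass `pw K * pw K`.
  average : ∀ {K} → System K → (X K → Y K → ℤ) → ℤ
  average {K} c f = ∑ (allX K) (λ x → ∑ (allY K) (λ y → riesz c x y * f x y))

  average-+ : ∀ K (c : System K) f g → average c (λ x y → f x y + g x y) ≡ average c f + average c g
  average-+ K c f g = trans
    (∑-cong (allX K) (λ x → trans (∑-cong (allY K) (λ y → *-distribˡ-+ (riesz c x y) (f x y) (g x y)))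
      (∑-+ (allY K) (λ y → riesz c x y * f x y) (λ y → riesz c x y * g x y))))
    (∑-+ (allX K) (λ x → ∑ (allY K) (λ y → riesz c x y * f x y))
        (λ x → ∑ (allY K) (λ y → riesz c x y * g x y)))

  average-mono : ∀ K (c : System K) f g → (∀ x y → f x y ≤ g x y) → average c f ≤ average c g
  average-mono K c f g f≤g = ∑-mono (allX K) (λ x → ∑-mono (allY K) (λ y →
    *-monoˡ-≤-nonNeg (riesz c x y) ⦃ nonNegative (riesz-nonneg c x y) ⦄ (f≤g x y)))

  average-const : ∀ K (c : System K) B → average c (λ _ _ → B) ≡ B * pw K * pw K
  average-const K c B = begin
    _ ≡⟨ ∑-cong (allX K) (λ x → trans (∑-cong (allY K) (λ y → *-comm (riesz c x y) B))
           (trans (∑-* B (allY K) (riesz c x))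
               (trans (cong (B *_) (riesz-mass K c x)) (sym (*-identityʳ (B * pw K)))))) ⟩
    ∑ (allX K) (λ _ → B * pw K * 1ℤ) ≡⟨ ∑-* (B * pw K) (allX K) (λ _ → 1ℤ) ⟩
    _ ≡⟨ cong (B * pw K *_) (allX-count K) ⟩
    _ ∎
    where open ≡-Reasoning

  -- Exchanging the sums leaves, for each point, the Riesz mass of the corners containing it.
  average-cornerSum : ∀ K (c : System K) t s →
    average c (cornerSum t s) ≡ ∑ (allX K) (λ p → colorVal (s p) * cornerMass c p (net t p))
  average-cornerSum K c t s = begin
    _ ≡⟨ ∑-cong (allX K) (λ x → trans
           (∑-cong (allY K) (λ y → trans
               (sym (∑-* (riesz c x y) (allX K) (λ p → colorVal (s p) * (leX p x * leY (net t p) y))))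
             (∑-cong (allX K) (λ p → reorder (riesz c x y) (colorVal (s p)) (leX p x) (leY (net t p) y)))))
           (∑-swap (allY K) (allX K) (λ y p → colorVal (s p) * leX p x * (riesz c x y * leY (net t p) y)))) ⟩
    _ ≡⟨ ∑-swap (allX K) (allX K)
        (λ x p → ∑ (allY K) (λ y → colorVal (s p) * leX p x * (riesz c x y * leY (net t p) y))) ⟩
    _ ≡⟨ ∑-cong (allX K) (λ p → trans
           (∑-cong (allX K) (λ x → trans
             (∑-* (colorVal (s p) * leX p x) (allY K) (λ y → riesz c x y * leY (net t p) y))
             (*-assoc (colorVal (s p)) (leX p x) (tailSum c x (net t p)))))
           (∑-* (colorVal (s p)) (allX K) (λ x → leX p x * tailSum c x (net t p)))) ⟩
    _ ∎
    where
    open ≡-Reasoning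
    reorder : ∀ r v l m → r * (v * (l * m)) ≡ v * l * (r * m)
    reorder = solve-∀

  netArea : ∀ {K} → Tree K → Signs K → ℤ
  netArea {K} t s = ∑ (allX K) (λ p → colorVal (s p) * area p (net t p))

  average-gain : ∀ K (c : System K) t s → (∀ p → Compatible c p (net t p)) →
    + 16 * average c (cornerSum t s) ≡ + 16 * netArea t s + pw K * netGain c t s
  average-gain K c t s comp = begin
    _ ≡⟨ cong (+ 16 *_) (average-cornerSum K c t s) ⟩
    _ ≡⟨ sym (∑-* (+ 16) (allX K) (λ p → colorVal (s p) * cornerMass c p (net t p))) ⟩
    _ ≡⟨ ∑-cong (allX K) (λ p → trans (commute (colorVal (s p)) (cornerMass c p (net t p)))
           (trans (cong (colorVal (s p) *_) (cornerMass-gain K c p (net t p) (comp p)))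
             (expand (colorVal (s p)) (area p (net t p)) (pw K) (gain c p (net t p))))) ⟩
    _ ≡⟨ ∑-+ (allX K) (λ p → + 16 * (colorVal (s p) * area p (net t p)))
        (λ p → pw K * (colorVal (s p) * gain c p (net t p))) ⟩
    _ ≡⟨ cong₂ _+_ (∑-* (+ 16) (allX K) (λ p → colorVal (s p) * area p (net t p)))
           (∑-* (pw K) (allX K) (λ p → colorVal (s p) * gain c p (net t p))) ⟩
    _ ∎
    where
    open ≡-Reasoning
    commute : ∀ v w → + 16 * (v * w) ≡ v * (+ 16 * w)
    commute = solve-∀
    expand : ∀ v a P g → v * (+ 16 * a + P * g) ≡ + 16 * (v * a) + P * (v * g)
    expand = solve-∀

  -- Its Riesz product is 1. It treats the plain integral as another instance of `average-gain`,
  -- with the same `netArea` and no gain.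
  zeroSystem : ∀ K → System K
  zeroSystem zero    = tt
  zeroSystem (suc K) = (λ _ _ _ → nil) , (λ _ _ → zeroSystem K)

  zeroSystem-compatible : ∀ K x p → Compatible (zeroSystem K) x p
  zeroSystem-compatible zero    _ _ = tt
  zeroSystem-compatible (suc K) (x , x″ , x′) (p′ , p″ , p) =
    *-zeroʳ (ε x′) , *-zeroʳ (ε p″) , zeroSystem-compatible K x p

  zeroSystem-gain : ∀ K x p → gain (zeroSystem K) x p ≡ 0ℤ
  zeroSystem-gain zero    _ _ = refl
  zeroSystem-gain (suc K) (x , x″ , x′) (p′ , p″ , p) =
    cong₂ _+_ (*-zeroʳ ((τ x′ + ε x′) * τ p″)) (zeroSystem-gain K x p)

  average-zeroSystem : ∀ K t s → + 16 * average (zeroSystem K) (cornerSum t s) ≡ + 16 * netArea t s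
  average-zeroSystem K t s = begin
    _ ≡⟨ average-gain K (zeroSystem K) t s (λ p → zeroSystem-compatible K p (net t p)) ⟩
    _ ≡⟨ cong (λ z → + 16 * netArea t s + pw K * z) (trans
           (∑-cong (allX K) (λ p → trans (cong (colorVal (s p) *_) (zeroSystem-gain K p (net t p)))
               (*-zeroʳ (colorVal (s p)))))
           (∑-zero (allX K))) ⟩
    _ ≡⟨ drop (+ 16 * netArea t s) (pw K) ⟩
    _ ∎
    where
    open ≡-Reasoning
    drop : ∀ a b → a + b * 0ℤ ≡ a
    drop = solve-∀

  -- The integrals of `D` against the aligned product and against 1 differ by one sixteenth of
  -- `pw K * treeDist t₁ t₂`, and each is at most `B * pw K * pw K` in absolute value. Two such
  -- integrals times 16 give the constant 32.
  treeDist-bound : ∀ K (t₁ t₂ : Tree K) s₁ s₂ (B : ℤ) →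
    (∀ x y → cornerSum t₁ s₁ x y + cornerSum t₂ s₂ x y ≤ B) →
    (∀ x y → - B ≤ cornerSum t₁ s₁ x y + cornerSum t₂ s₂ x y) →
    treeDist t₁ t₂ ≤ + 32 * B * pw K
  treeDist-bound K t₁ t₂ s₁ s₂ B D≤B -B≤D =
    *-cancelˡ-≤-pos (treeDist t₁ t₂) (+ 32 * B * pw K) (pw K) ⦃ pw-positive ⦄ scaled
    where
    pw-positive : Positive (pw K)
    pw-positive = subst Positive (sym (pw-pos K)) (positive (+<+ (ℕP.m^n>0 16 K)))
    D : X K → Y K → ℤ
    D x y = cornerSum t₁ s₁ x y + cornerSum t₂ s₂ x y
    c = align t₁ t₂ s₁ s₂
    z = zeroSystem K
    V = netArea t₁ s₁ + netArea t₂ s₂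
    with-c : + 16 * average c D ≡ + 16 * V + pw K * treeDist t₁ t₂
    with-c = begin
      _ ≡⟨ cong (+ 16 *_) (average-+ K c (cornerSum t₁ s₁) (cornerSum t₂ s₂)) ⟩
      _ ≡⟨ *-distribˡ-+ (+ 16) (average c (cornerSum t₁ s₁)) (average c (cornerSum t₂ s₂)) ⟩
      _ ≡⟨ cong₂ _+_ (average-gain K c t₁ s₁ (align-compatible₁ K t₁ t₂ s₁ s₂))
                     (average-gain K c t₂ s₂ (align-compatible₂ K t₁ t₂ s₁ s₂)) ⟩
      _ ≡⟨ collect (netArea t₁ s₁) (netArea t₂ s₂) (pw K) (netGain c t₁ s₁) (netGain c t₂ s₂) ⟩
      _ ≡⟨ cong (λ g → + 16 * V + pw K * g) (align-gain K t₁ t₂ s₁ s₂) ⟩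
      _ ∎
      where
      open ≡-Reasoning
      collect : ∀ a b P g h → (+ 16 * a + P * g) + (+ 16 * b + P * h) ≡ + 16 * (a + b) + P * (g + h)
      collect = solve-∀
    with-z : + 16 * average z D ≡ + 16 * V
    with-z = begin
      _ ≡⟨ cong (+ 16 *_) (average-+ K z (cornerSum t₁ s₁) (cornerSum t₂ s₂)) ⟩
      _ ≡⟨ *-distribˡ-+ (+ 16) (average z (cornerSum t₁ s₁)) (average z (cornerSum t₂ s₂)) ⟩
      _ ≡⟨ cong₂ _+_ (average-zeroSystem K t₁ s₁) (average-zeroSystem K t₂ s₂) ⟩
      _ ≡⟨ sym (*-distribˡ-+ (+ 16) (netArea t₁ s₁) (netArea t₂ s₂)) ⟩
      _ ∎
      where open ≡-Reasoning
    scaled : pw K * treeDist t₁ t₂ ≤ pw K * (+ 32 * B * pw K)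
    scaled = begin
      pw K * treeDist t₁ t₂
        ≡⟨ cancel (+ 16 * V) (pw K * treeDist t₁ t₂) ⟩
      (+ 16 * V + pw K * treeDist t₁ t₂) - + 16 * V
        ≡⟨ cong₂ _-_ (sym with-c) (sym with-z) ⟩
      + 16 * average c D - + 16 * average z D
        ≤⟨ +-mono-≤ (*-monoˡ-≤-nonNeg (+ 16) (average-mono K c D (λ _ _ → B) D≤B))
                    (neg-mono-≤ (*-monoˡ-≤-nonNeg (+ 16) (average-mono K z (λ _ _ → - B) D -B≤D))) ⟩
      + 16 * average c (λ _ _ → B) - + 16 * average z (λ _ _ → - B)
        ≡⟨ cong₂ (λ v w → + 16 * v - + 16 * w) (average-const K c B) (average-const K z (- B)) ⟩
      + 16 * (B * pw K * pw K) - + 16 * (- B * pw K * pw K)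
        ≡⟨ total B (pw K) ⟩
      _ ∎
      where
      open ≤-Reasoning
      cancel : ∀ a b → b ≡ (a + b) - a
      cancel = solve-∀
      total : ∀ B P → + 16 * (B * P * P) - + 16 * (- B * P * P) ≡ P * (+ 32 * B * P)
      total = solve-∀

  -- Trees read off from bit strings

  ∑< : ℕ → (ℕ → ℤ) → ℤ
  ∑< zero    f = 0ℤ
  ∑< (suc n) f = f 0 + ∑< n (f ∘ suc)

  ∑<-cong : ∀ n {f g : ℕ → ℤ} → (∀ i → f i ≡ g i) → ∑< n f ≡ ∑< n g
  ∑<-cong zero    e = refl
  ∑<-cong (suc n) e = cong₂ _+_ (e 0) (∑<-cong n (e ∘ suc))

  ∑<-+ : ∀ m n f → ∑< (m ℕ.+ n) f ≡ ∑< m f + ∑< n (λ i → f (m ℕ.+ i))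
  ∑<-+ zero    n f = sym (+-identityˡ _)
  ∑<-+ (suc m) n f = trans (cong (_+_ (f 0)) (∑<-+ m n (f ∘ suc))) (sym (+-assoc (f 0) _ _))

  ∑<-* : ∀ m n f → ∑< (m ℕ.* n) f ≡ ∑< m (λ q → ∑< n (λ r → f (q ℕ.* n ℕ.+ r)))
  ∑<-* zero    n f = refl
  ∑<-* (suc m) n f = trans (∑<-+ n (m ℕ.* n) f) (cong (_+_ (∑< n f))
    (trans (∑<-* m n (λ i → f (n ℕ.+ i)))
      (∑<-cong m (λ q → ∑<-cong n (λ r → cong f (sym (ℕP.+-assoc n (q ℕ.* n) r)))))))

  opaque
    unfolding digits

    ∑-digits : ∀ f → ∑ digits (λ d → f (toℕ d)) ≡ ∑< 4 f
    ∑-digits f = refl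

  encX : ∀ {K} → X K → ℕ
  encX {zero}  _             = 0
  encX {suc K} (u , a″ , a′) = (encX u ℕ.* 4 ℕ.+ toℕ a″) ℕ.* 4 ℕ.+ toℕ a′

  ∑-encX : ∀ K f → ∑ (allX K) (f ∘ encX) ≡ ∑< (16 ℕ.^ K) f
  ∑-encX zero    f = refl
  ∑-encX (suc K) f = begin
    _ ≡⟨ ∑X-suc K (f ∘ encX) ⟩
    _ ≡⟨ ∑-cong (allX K)
        (λ u → trans (∑-cong digits (λ a″ → ∑-digits (λ r → f ((encX u ℕ.* 4 ℕ.+ toℕ a″) ℕ.* 4 ℕ.+ r))))
           (∑-digits (λ q → ∑< 4 (λ r → f ((encX u ℕ.* 4 ℕ.+ q) ℕ.* 4 ℕ.+ r))))) ⟩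
    _ ≡⟨ ∑-encX K (λ p → ∑< 4 (λ q → ∑< 4 (λ r → f ((p ℕ.* 4 ℕ.+ q) ℕ.* 4 ℕ.+ r)))) ⟩
    _ ≡⟨ sym (∑<-* (16 ℕ.^ K) 4 (λ q → ∑< 4 (λ r → f (q ℕ.* 4 ℕ.+ r)))) ⟩
    _ ≡⟨ sym (∑<-* (16 ℕ.^ K ℕ.* 4) 4 f) ⟩
    _ ≡⟨ cong (λ n → ∑< n f) (sixteen (16 ℕ.^ K)) ⟩
    _ ∎
    where
    open ≡-Reasoning
    sixteen : ∀ n → n ℕ.* 4 ℕ.* 4 ≡ 16 ℕ.* n
    sixteen = ℕSolver.solve-∀

  Bits : Set
  Bits = ℕ → Bool

  hamming : ℕ → Bits → Bits → ℕ
  hamming zero    β γ = 0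
  hamming (suc n) β γ = diff (β 0) (γ 0) ℕ.+ hamming n (β ∘ suc) (γ ∘ suc)

  hamming-∑ : ∀ n β γ → + hamming n β γ ≡ ∑< n (λ i → + diff (β i) (γ i))
  hamming-∑ zero    β γ = refl
  hamming-∑ (suc n) β γ = trans (pos-+ (diff (β 0) (γ 0)) _)
      (cong (_+_ (+ diff (β 0) (γ 0))) (hamming-∑ n (β ∘ suc) (γ ∘ suc)))

  bitCount : ℕ → ℕ
  bitCount zero    = 0
  bitCount (suc K) = 16 ℕ.^ K ℕ.+ 4 ℕ.* 4 ℕ.* bitCount K

  -- Going down one level multiplies the number of subtrees by 16 and divides the bits at each root
  -- by 16, so all `K` levels hold equally many bits.
  bitCount-closed : ∀ K → 16 ℕ.* bitCount K ≡ K ℕ.* 16 ℕ.^ K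
  bitCount-closed zero    = refl
  bitCount-closed (suc K) = trans (expand (16 ℕ.^ K) (bitCount K))
      (trans (cong (λ z → 16 ℕ.* (16 ℕ.^ K ℕ.+ z)) (bitCount-closed K)) (collect K (16 ℕ.^ K)))
    where
    expand : ∀ P b → 16 ℕ.* (P ℕ.+ 4 ℕ.* 4 ℕ.* b) ≡ 16 ℕ.* (P ℕ.+ 16 ℕ.* b)
    expand = ℕSolver.solve-∀
    collect : ∀ K P → 16 ℕ.* (P ℕ.+ K ℕ.* P) ≡ (1 ℕ.+ K) ℕ.* (16 ℕ.* P)
    collect = ℕSolver.solve-∀

  -- The bits of the root come first, then sixteen consecutive blocks, one for each branch. Every
  -- bit is thus read exactly once, which makes `treeDist` a Hamming distance.
  subBits : ℕ → Bits → Digit → Digit → Bits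
  subBits K β y′ y″ i = β (16 ℕ.^ K ℕ.+ ((toℕ y′ ℕ.* 4 ℕ.+ toℕ y″) ℕ.* bitCount K ℕ.+ i))

  tree : ∀ K → Bits → Tree K
  tree zero    β = tt
  tree (suc K) β = (λ u → β (encX u)) , (λ y′ y″ → tree K (subBits K β y′ y″))

  treeDist-hamming : ∀ K β γ → treeDist (tree K β) (tree K γ) ≡ + hamming (bitCount K) β γ
  treeDist-hamming zero    β γ = refl
  treeDist-hamming (suc K) β γ = begin
    _ ≡⟨ cong₂ _+_ (∑-encX K f)
           (∑-cong digits (λ y′ → ∑-cong digits (λ y″ →
             trans (treeDist-hamming K (subBits K β y′ y″) (subBits K γ y′ y″))
                   (hamming-∑ (bitCount K) (subBits K β y′ y″) (subBits K γ y′ y″))))) ⟩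
    _ ≡⟨ cong (_+_ (∑< (16 ℕ.^ K) f)) (trans
           (trans (∑-cong digits (λ y′ → ∑-digits (λ r → sub (toℕ y′ ℕ.* 4 ℕ.+ r))))
             (∑-digits (λ q → ∑< 4 (λ r → sub (q ℕ.* 4 ℕ.+ r)))))
           (trans (sym (∑<-* 4 4 sub)) (sym (∑<-* (4 ℕ.* 4) (bitCount K) (λ i → f (16 ℕ.^ K ℕ.+ i)))))) ⟩
    _ ≡⟨ sym (∑<-+ (16 ℕ.^ K) (4 ℕ.* 4 ℕ.* bitCount K) f) ⟩
    _ ≡⟨ sym (hamming-∑ (bitCount (suc K)) β γ) ⟩
    _ ∎
    where
    open ≡-Reasoning
    f : ℕ → ℤ
    f i = + diff (β i) (γ i)
    sub : ℕ → ℤ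
    sub q = ∑< (bitCount K) (λ j → f (16 ℕ.^ K ℕ.+ (q ℕ.* bitCount K ℕ.+ j)))

  -- Codes of linear distance and rate

  prepend : Bool → Bits → Bits
  prepend b β zero    = b
  prepend b β (suc i) = β i

  words : ℕ → List Bits
  words zero    = (λ _ → false) ∷ []
  words (suc n) = map (prepend false) (words n) ++ map (prepend true) (words n)

  length-words : ∀ n → length (words n) ≡ 2 ℕ.^ n
  length-words zero    = refl
  length-words (suc n) = trans (length-++ (map (prepend false) (words n)))
    (trans (cong₂ ℕ._+_ (trans (length-map (prepend false) (words n)) (length-words n))
                        (trans (length-map (prepend true) (words n)) (length-words n)))
      (cong (2 ℕ.^ n ℕ.+_) (sym (ℕP.+-identityʳ (2 ℕ.^ n)))))

  agreement : Bool → Bool → ℕ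
  agreement false false = 8
  agreement false true  = 1
  agreement true  false = 1
  agreement true  true  = 8

  -- This is 8 to the number of agreements, an exponential weight that replaces counting the words
  -- in a Hamming ball.
  weight : ℕ → Bits → Bits → ℕ
  weight zero    β γ = 1
  weight (suc n) β γ = agreement (β 0) (γ 0) ℕ.* weight n (β ∘ suc) (γ ∘ suc)

  weight-sym : ∀ n β γ → weight n β γ ≡ weight n γ β
  weight-sym zero    β γ = refl
  weight-sym (suc n) β γ = cong₂ ℕ._*_ (agreement-sym (β 0) (γ 0)) (weight-sym n (β ∘ suc) (γ ∘ suc))
    where
    agreement-sym : ∀ b c → agreement b c ≡ agreement c b
    agreement-sym false false = refl
    agreement-sym false true  = refl
    agreement-sym true  false = refl
    agreement-sym true  true  = refl

  weight-hamming : ∀ n β γ → weight n β γ ℕ.* 8 ℕ.^ hamming n β γ ≡ 8 ℕ.^ n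
  weight-hamming zero    β γ = refl
  weight-hamming (suc n) β γ = trans
    (cong (agreement (β 0) (γ 0) ℕ.* weight n (β ∘ suc) (γ ∘ suc) ℕ.*_)
        (ℕP.^-distribˡ-+-* 8 (diff (β 0) (γ 0)) _))
    (trans (regroup (agreement (β 0) (γ 0)) (weight n (β ∘ suc) (γ ∘ suc)) (8 ℕ.^ diff (β 0) (γ 0)) _)
      (cong₂ ℕ._*_ (letter (β 0) (γ 0)) (weight-hamming n (β ∘ suc) (γ ∘ suc))))
    where
    regroup : ∀ a b c d → a ℕ.* b ℕ.* (c ℕ.* d) ≡ a ℕ.* c ℕ.* (b ℕ.* d)
    regroup = ℕSolver.solve-∀
    letter : ∀ b c → agreement b c ℕ.* 8 ℕ.^ diff b c ≡ 8
    letter false false = refl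
    letter false true  = refl
    letter true  false = refl
    letter true  true  = refl

  weight-self : ∀ n β → weight n β β ≡ 8 ℕ.^ n
  weight-self zero    β = refl
  weight-self (suc n) β = cong₂ ℕ._*_ (letter (β 0)) (weight-self n (β ∘ suc))
    where
    letter : ∀ b → agreement b b ≡ 8
    letter false = refl
    letter true  = refl

  -- The sum factorises over the letters, and each letter gives 8 + 1 whatever the letter of `γ`.
  weight-total : ∀ n γ → ∑ (words n) (λ β → + weight n β γ) ≡ + (9 ℕ.^ n)
  weight-total zero    γ = refl
  weight-total (suc n) γ = begin
    _ ≡⟨ ∑-++ (map (prepend false) (words n)) (map (prepend true) (words n)) (λ β → + weight (suc n) β γ) ⟩
    _ ≡⟨ cong₂ _+_ (half false) (half true) ⟩
    + agreement false (γ 0) * + (9 ℕ.^ n) + + agreement true (γ 0) * + (9 ℕ.^ n)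
      ≡⟨ nine (γ 0) (+ (9 ℕ.^ n)) ⟩
    + 9 * + (9 ℕ.^ n) ≡⟨ sym (pos-* 9 (9 ℕ.^ n)) ⟩
    _ ∎
    where
    open ≡-Reasoning
    half : ∀ b → ∑ (map (prepend b) (words n)) (λ β → + weight (suc n) β γ) ≡ + agreement b (γ 0) * +
        (9 ℕ.^ n)
    half b = trans (∑-map (prepend b) (words n) (λ β → + weight (suc n) β γ))
      (trans (∑-cong (words n) (λ β → pos-* (agreement b (γ 0)) (weight n β (γ ∘ suc))))
        (trans (∑-* (+ agreement b (γ 0)) (words n) (λ β → + weight n β (γ ∘ suc)))
          (cong (+ agreement b (γ 0) *_) (weight-total n (γ ∘ suc)))))
    nine₁ : ∀ x → + 8 * x + + 1 * x ≡ + 9 * x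
    nine₁ = solve-∀
    nine₂ : ∀ x → + 1 * x + + 8 * x ≡ + 9 * x
    nine₂ = solve-∀
    nine : ∀ c x → + agreement false c * x + + agreement true c * x ≡ + 9 * x
    nine false = nine₁
    nine true  = nine₂

  ∑-const : ∀ {A : Set} (xs : List A) k → ∑ xs (λ _ → k) ≡ + length xs * k
  ∑-const []       k = refl
  ∑-const (x ∷ xs) k = trans (cong (_+_ k) (∑-const xs k)) (step (+ length xs) k)
    where
    step : ∀ n k → k + n * k ≡ (1ℤ + n) * k
    step = solve-∀

  ∑-nonneg : ∀ {A : Set} (xs : List A) (f : A → ℕ) → 0ℤ ≤ ∑ xs (λ x → + f x)
  ∑-nonneg []       f = +≤+ ℕ.z≤n
  ∑-nonneg (x ∷ xs) f = +-mono-≤ (+≤+ (ℕ.z≤n {f x})) (∑-nonneg xs f)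

  term≤∑ : ∀ {A : Set} (xs : List A) (f : A → ℕ) i → + f (lookup xs i) ≤ ∑ xs (λ x → + f x)
  term≤∑ (x ∷ xs) f zero    = ≤-trans (≤-reflexive (sym (+-identityʳ (+ f x))))
      (+-monoʳ-≤ (+ f x) (∑-nonneg xs f))
  term≤∑ (x ∷ xs) f (suc i) = ≤-trans (term≤∑ xs f i) (i≤j+i (∑ xs (λ x → + f x)) (+ f x))

  -- Greedy choice: a word is added when its total weight against the words
  -- already chosen is below the threshold.
  greedy : ∀ n (T : ℕ) → T ℕ.≤ 8 ℕ.^ n → (xs : List Bits) → ∃ λ ys →
    (∀ i j → i ≢ j → weight n (lookup ys i) (lookup ys j) ℕ.< T) ×
    ∑ xs (λ _ → + T) ≤ ∑ xs (λ x → ∑ ys (λ y → + weight n x y))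
  greedy n T T≤ []       = [] , (λ ()) , ≤-refl
  greedy n T T≤ (x ∷ xs) with greedy n T T≤ xs
  ... | ys , far , cover with + T ≤? ∑ ys (λ y → + weight n x y)
  ...   | yes T≤∑ = ys , far , +-mono-≤ T≤∑ cover
  ...   | no  T≰∑ = x ∷ ys , far′ , +-mono-≤ self (≤-trans cover (∑-mono xs grow))
    where
    new : ∀ j → weight n x (lookup ys j) ℕ.< T
    new j = drop‿+<+ (≤-<-trans (term≤∑ ys (weight n x) j) (≰⇒> T≰∑))
    far′ : ∀ i j → i ≢ j → weight n (lookup (x ∷ ys) i) (lookup (x ∷ ys) j) ℕ.< T
    far′ zero    zero    i≢j = contradiction refl i≢j
    far′ zero    (suc j) _   = new j
    far′ (suc i) zero    _   = subst (ℕ._< T) (weight-sym n x (lookup ys i)) (new i)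
    far′ (suc i) (suc j) i≢j = far i j (λ e → i≢j (cong suc e))
    self : + T ≤ ∑ (x ∷ ys) (λ y → + weight n x y)
    self = ≤-trans (+≤+ (subst (T ℕ.≤_) (sym (weight-self n x)) T≤)) (term≤∑ (x ∷ ys) (weight n x) zero)
    grow : ∀ z → ∑ ys (λ y → + weight n z y) ≤ ∑ (x ∷ ys) (λ y → + weight n z y)
    grow z = i≤j+i (∑ ys (λ y → + weight n z y)) (+ weight n z x)

  -- Counting gives 2^(16M) · 8^(15M) ≤ |code| · 9^(16M), and 9^16 ≤ 2^51.
  code-exists : ∀ M → ∃ λ (ys : List Bits) →
    (∀ i j → i ≢ j → M ℕ.< hamming (16 ℕ.* M) (lookup ys i) (lookup ys j)) ×
    2 ℕ.^ (10 ℕ.* M) ℕ.≤ length ys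
  code-exists M with greedy (16 ℕ.* M) (8 ℕ.^ (15 ℕ.* M)) (ℕP.^-monoʳ-≤ 8 (ℕP.*-monoˡ-≤ M (ℕP.m≤m+n 15 1)))
      (words (16 ℕ.* M))
  ... | ys , far , cover = ys , far′ , many
    where
    far′ : ∀ i j → i ≢ j → M ℕ.< hamming (16 ℕ.* M) (lookup ys i) (lookup ys j)
    -- A distance of at most `M` would force a weight of at least `8 ^ (15 * M)`, the greedy
    -- threshold.
    far′ i j i≢j with M ℕP.<? hamming (16 ℕ.* M) (lookup ys i) (lookup ys j)
    ... | yes M<h = M<h
    ... | no  M≮h = contradiction (weight-hamming (16 ℕ.* M) (lookup ys i) (lookup ys j)) (ℕP.<⇒≢ small)
      where
      open ℕP.≤-Reasoning
      split : ∀ M → 15 ℕ.* M ℕ.+ M ≡ 16 ℕ.* M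
      split = ℕSolver.solve-∀
      small : weight (16 ℕ.* M) (lookup ys i) (lookup ys j) ℕ.* 8 ℕ.^ hamming (16 ℕ.* M) (lookup ys i)
          (lookup ys j) ℕ.< 8 ℕ.^ (16 ℕ.* M)
      small = begin-strict
        _ ≤⟨ ℕP.*-monoʳ-≤ (weight (16 ℕ.* M) (lookup ys i) (lookup ys j)) (ℕP.^-monoʳ-≤ 8 (ℕP.≮⇒≥ M≮h)) ⟩
        weight (16 ℕ.* M) (lookup ys i) (lookup ys j) ℕ.* 8 ℕ.^ M
          <⟨ ℕP.*-monoˡ-< (8 ℕ.^ M) ⦃ ℕP.m^n≢0 8 M ⦄ (far i j i≢j) ⟩
        8 ℕ.^ (15 ℕ.* M) ℕ.* 8 ℕ.^ M ≡⟨ sym (ℕP.^-distribˡ-+-* 8 (15 ℕ.* M) M) ⟩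
        8 ℕ.^ (15 ℕ.* M ℕ.+ M) ≡⟨ cong (8 ℕ.^_) (split M) ⟩
        8 ℕ.^ (16 ℕ.* M) ∎
    volume : 2 ℕ.^ (16 ℕ.* M) ℕ.* 8 ℕ.^ (15 ℕ.* M) ℕ.≤ length ys ℕ.* 9 ℕ.^ (16 ℕ.* M)
    volume = drop‿+≤+ (begin
      + (2 ℕ.^ (16 ℕ.* M) ℕ.* 8 ℕ.^ (15 ℕ.* M))
        ≡⟨ pos-* (2 ℕ.^ (16 ℕ.* M)) _ ⟩
      + (2 ℕ.^ (16 ℕ.* M)) * + (8 ℕ.^ (15 ℕ.* M))
        ≡⟨ cong (λ l → + l * + (8 ℕ.^ (15 ℕ.* M))) (sym (length-words (16 ℕ.* M))) ⟩
      _ ≡⟨ sym (∑-const (words (16 ℕ.* M)) (+ (8 ℕ.^ (15 ℕ.* M)))) ⟩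
      _ ≤⟨ cover ⟩
      _ ≡⟨ ∑-swap (words (16 ℕ.* M)) ys (λ x y → + weight (16 ℕ.* M) x y) ⟩
      _ ≡⟨ ∑-cong ys (λ y → weight-total (16 ℕ.* M) y) ⟩
      _ ≡⟨ ∑-const ys (+ (9 ℕ.^ (16 ℕ.* M))) ⟩
      _ ≡⟨ sym (pos-* (length ys) _) ⟩
      _ ∎)
      where open ≤-Reasoning
    many : 2 ℕ.^ (10 ℕ.* M) ℕ.≤ length ys
    many = ℕP.*-cancelʳ-≤ _ _ (2 ℕ.^ (51 ℕ.* M)) ⦃ ℕP.m^n≢0 2 (51 ℕ.* M) ⦄ (begin
      2 ℕ.^ (10 ℕ.* M) ℕ.* 2 ℕ.^ (51 ℕ.* M) ≡⟨ sym (ℕP.^-distribˡ-+-* 2 (10 ℕ.* M) (51 ℕ.* M)) ⟩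
      2 ℕ.^ (10 ℕ.* M ℕ.+ 51 ℕ.* M) ≡⟨ cong (2 ℕ.^_) (exponents M) ⟩
      2 ℕ.^ (16 ℕ.* M ℕ.+ 3 ℕ.* (15 ℕ.* M)) ≡⟨ ℕP.^-distribˡ-+-* 2 (16 ℕ.* M) (3 ℕ.* (15 ℕ.* M)) ⟩
      2 ℕ.^ (16 ℕ.* M) ℕ.* 2 ℕ.^
          (3 ℕ.* (15 ℕ.* M)) ≡⟨ cong (2 ℕ.^ (16 ℕ.* M) ℕ.*_) (sym (ℕP.^-*-assoc 2 3 (15 ℕ.* M))) ⟩
      2 ℕ.^ (16 ℕ.* M) ℕ.* 8 ℕ.^ (15 ℕ.* M) ≤⟨ volume ⟩
      length ys ℕ.* 9 ℕ.^ (16 ℕ.* M) ≤⟨ ℕP.*-monoʳ-≤ (length ys) nines ⟩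
      length ys ℕ.* 2 ℕ.^ (51 ℕ.* M) ∎)
      where
      open ℕP.≤-Reasoning
      exponents : ∀ M → 10 ℕ.* M ℕ.+ 51 ℕ.* M ≡ 16 ℕ.* M ℕ.+ 3 ℕ.* (15 ℕ.* M)
      exponents = ℕSolver.solve-∀
      nines : 9 ℕ.^ (16 ℕ.* M) ℕ.≤ 2 ℕ.^ (51 ℕ.* M)
      nines = begin
        9 ℕ.^ (16 ℕ.* M)  ≡⟨ sym (ℕP.^-*-assoc 9 16 M) ⟩
        (9 ℕ.^ 16) ℕ.^ M  ≤⟨ ℕP.^-monoˡ-≤ M (ℕP.≤ᵇ⇒≤ (9 ℕ.^ 16) (2 ℕ.^ 51) tt) ⟩
        (2 ℕ.^ 51) ℕ.^ M  ≡⟨ ℕP.^-*-assoc 2 51 M ⟩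
        2 ℕ.^ (51 ℕ.* M)  ∎

  -- Digit strings as numbers, and the agreement of their orders

  le : ℕ → ℕ → ℤ
  le m n = ind (m ℕ.≤ᵇ n)

  lt-yes : ∀ {m n} → m ℕ.< n → lt m n ≡ 1ℤ
  lt-yes {m} {n} p = cong ind (dec-true (m ℕP.<? n) p)

  lt-no : ∀ {m n} → ¬ m ℕ.< n → lt m n ≡ 0ℤ
  lt-no {m} {n} p = cong ind (dec-false (m ℕP.<? n) p)

  eq-no : ∀ {m n} → m ≢ n → eq m n ≡ 0ℤ
  eq-no {m} {n} p = cong ind (dec-false (m ℕP.≟ n) p)

  eq-refl : ∀ m → eq m m ≡ 1ℤ
  eq-refl m = cong ind (dec-true (m ℕP.≟ m) refl)

  lt-+ : ∀ c a b → lt (c ℕ.+ a) (c ℕ.+ b) ≡ lt a b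
  lt-+ zero    a b = refl
  lt-+ (suc c) a b = lt-+ c a b

  eq-+ : ∀ c a b → eq (c ℕ.+ a) (c ℕ.+ b) ≡ eq a b
  eq-+ zero    a b = refl
  eq-+ (suc c) a b = eq-+ c a b

  le-split : ∀ m n → le m n ≡ lt m n + eq m n
  le-split zero    zero    = refl
  le-split zero    (suc n) = refl
  le-split (suc m) zero    = refl
  le-split (suc m) (suc n) = trans (le-suc m n) (le-split m n)
    where
    le-suc : ∀ m n → le (suc m) (suc n) ≡ le m n
    le-suc zero    n = refl
    le-suc (suc m) n = refl

  block-< : ∀ m {p q a b} → p ℕ.< q → a ℕ.< m → p ℕ.* m ℕ.+ a ℕ.< q ℕ.* m ℕ.+ b
  block-< m {p} {q} {a} {b} p<q a<m = begin-strict
    p ℕ.* m ℕ.+ a <⟨ ℕP.+-monoʳ-< (p ℕ.* m) a<m ⟩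
    p ℕ.* m ℕ.+ m ≡⟨ ℕP.+-comm (p ℕ.* m) m ⟩
    suc p ℕ.* m   ≤⟨ ℕP.*-monoˡ-≤ m p<q ⟩
    q ℕ.* m       ≤⟨ ℕP.m≤m+n (q ℕ.* m) b ⟩
    _ ∎
    where open ℕP.≤-Reasoning

  lt-lex : ∀ m p q {a b} → a ℕ.< m → b ℕ.< m → lt (p ℕ.* m ℕ.+ a) (q ℕ.* m ℕ.+ b) ≡ lt p q + eq p q * lt a b
  lt-lex m p q {a} {b} a<m b<m with ℕP.<-cmp p q
  ... | tri< p<q p≢q _ rewrite lt-yes (block-< m {b = b} p<q a<m) | lt-yes p<q | eq-no p≢q = refl
  ... | tri> p≮q p≢q q<p rewrite lt-no (ℕP.<-asym (block-< m {b = a} q<p b<m)) | lt-no p≮q | eq-no p≢q = refl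
  ... | tri≈ p≮p refl _ rewrite lt-+ (p ℕ.* m) a b | lt-no p≮p | eq-refl p = sym
      (trans (+-identityˡ _) (*-identityˡ (lt a b)))

  eq-lex : ∀ m p q {a b} → a ℕ.< m → b ℕ.< m → eq (p ℕ.* m ℕ.+ a) (q ℕ.* m ℕ.+ b) ≡ eq p q * eq a b
  eq-lex m p q {a} {b} a<m b<m with ℕP.<-cmp p q
  ... | tri< p<q p≢q _ rewrite eq-no (ℕP.<⇒≢ (block-< m {b = b} p<q a<m)) | eq-no p≢q = refl
  ... | tri> _ p≢q q<p rewrite eq-no (ℕP.>⇒≢ (block-< m {b = a} q<p b<m)) | eq-no p≢q = refl
  ... | tri≈ _ refl _ rewrite eq-+ (p ℕ.* m) a b | eq-refl p = sym (*-identityˡ (eq a b))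

  encY : ∀ {K} → Y K → ℕ
  encY {zero}  _             = 0
  encY {suc K} (y′ , y″ , y) = (toℕ y′ ℕ.* 4 ℕ.+ toℕ y″) ℕ.* 16 ℕ.^ K ℕ.+ encY y

  pair-bound : ∀ m n {a b} → a ℕ.< m → b ℕ.< n → a ℕ.* n ℕ.+ b ℕ.< m ℕ.* n
  pair-bound m n {a} {b} a<m b<n = subst (a ℕ.* n ℕ.+ b ℕ.<_) (ℕP.+-identityʳ (m ℕ.* n)) (block-< n a<m b<n)

  encX-bound : ∀ {K} (x : X K) → encX x ℕ.< 16 ℕ.^ K
  encX-bound {zero}  _ = ℕP.≤-refl
  encX-bound {suc K} (u , a″ , a′) = subst (encX (u , a″ , a′) ℕ.<_) (sixteen (16 ℕ.^ K))
    (pair-bound (16 ℕ.^ K ℕ.* 4) 4 (pair-bound (16 ℕ.^ K) 4 (encX-bound u) (toℕ<n a″)) (toℕ<n a′))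
    where
    sixteen : ∀ n → n ℕ.* 4 ℕ.* 4 ≡ 16 ℕ.* n
    sixteen = ℕSolver.solve-∀

  encY-bound : ∀ {K} (y : Y K) → encY y ℕ.< 16 ℕ.^ K
  encY-bound {zero}  _ = ℕP.≤-refl
  encY-bound {suc K} (y′ , y″ , y) = pair-bound 16 (16 ℕ.^ K) (pair-bound 4 4 (toℕ<n y′) (toℕ<n y″))
      (encY-bound y)

  eqX-encX : ∀ {K} (p x : X K) → eqX p x ≡ eq (encX p) (encX x)
  eqX-encX {zero}  _ _ = refl
  eqX-encX {suc K} (p , p″ , p′) (x , x″ , x′) = sym (trans
    (eq-lex 4 (encX p ℕ.* 4 ℕ.+ toℕ p″) (encX x ℕ.* 4 ℕ.+ toℕ x″) (toℕ<n p′) (toℕ<n x′))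
    (trans (cong (_* eqᵈ p′ x′) (trans (eq-lex 4 (encX p) (encX x) (toℕ<n p″) (toℕ<n x″))
                                       (cong (_* eqᵈ p″ x″) (sym (eqX-encX p x)))))
      (*-assoc (eqX p x) (eqᵈ p″ x″) (eqᵈ p′ x′))))

  ltX-encX : ∀ {K} (p x : X K) → ltX p x ≡ lt (encX p) (encX x)
  ltX-encX {zero}  _ _ = refl
  ltX-encX {suc K} (p , p″ , p′) (x , x″ , x′) = sym (trans
    (lt-lex 4 (encX p ℕ.* 4 ℕ.+ toℕ p″) (encX x ℕ.* 4 ℕ.+ toℕ x″) (toℕ<n p′) (toℕ<n x′))
    (trans (cong₂ (λ l e → l + e * ltᵈ p′ x′)
             (trans (lt-lex 4 (encX p) (encX x) (toℕ<n p″) (toℕ<n x″))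
               (cong₂ (λ l e → l + e * ltᵈ p″ x″) (sym (ltX-encX p x)) (sym (eqX-encX p x))))
             (trans (eq-lex 4 (encX p) (encX x) (toℕ<n p″) (toℕ<n x″))
                 (cong (_* eqᵈ p″ x″) (sym (eqX-encX p x)))))
      (regroup (ltX p x) (eqX p x) (ltᵈ p″ x″) (eqᵈ p″ x″) (ltᵈ p′ x′))))
    where
    regroup : ∀ l q s t s′ → l + q * s + q * t * s′ ≡ l + q * (s + t * s′)
    regroup = solve-∀

  leX-encX : ∀ {K} (p x : X K) → leX p x ≡ le (encX p) (encX x)
  leX-encX p x = trans (cong₂ _+_ (ltX-encX p x) (eqX-encX p x)) (sym (le-split (encX p) (encX x)))

  leY-encY : ∀ {K} (p y : Y K) → leY p y ≡ le (encY p) (encY y)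
  leY-encY {zero}  _ _ = refl
  leY-encY {suc K} (p′ , p″ , p) (y′ , y″ , y) = sym (begin
    _ ≡⟨ le-split (encY (p′ , p″ , p)) (encY (y′ , y″ , y)) ⟩
    _ ≡⟨ cong₂ _+_ (lt-lex (16 ℕ.^ K) P Q (encY-bound p) (encY-bound y))
        (eq-lex (16 ℕ.^ K) P Q (encY-bound p) (encY-bound y)) ⟩
    lt P Q + eq P Q * lt (encY p) (encY y) + eq P Q * eq (encY p) (encY y)
      ≡⟨ factor (lt P Q) (eq P Q) (lt (encY p) (encY y)) (eq (encY p) (encY y)) ⟩
    lt P Q + eq P Q * (lt (encY p) (encY y) + eq (encY p) (encY y))
      ≡⟨ cong (λ z → lt P Q + eq P Q * z) (trans (sym (le-split (encY p) (encY y))) (sym (leY-encY p y))) ⟩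
    lt P Q + eq P Q * leY p y
      ≡⟨ cong₂ (λ l e → l + e * leY p y) (lt-lex 4 (toℕ p′) (toℕ y′) (toℕ<n p″) (toℕ<n y″))
                                        (eq-lex 4 (toℕ p′) (toℕ y′) (toℕ<n p″) (toℕ<n y″)) ⟩
    _ ≡⟨ regroup (ltᵈ p′ y′) (eqᵈ p′ y′) (ltᵈ p″ y″) (eqᵈ p″ y″) (leY p y) ⟩
    _ ∎)
    where
    open ≡-Reasoning
    P = toℕ p′ ℕ.* 4 ℕ.+ toℕ p″
    Q = toℕ y′ ℕ.* 4 ℕ.+ toℕ y″
    factor : ∀ l q s t → l + q * s + q * t ≡ l + q * (s + t)
    factor = solve-∀
    regroup : ∀ l q s t r → l + q * s + q * t * r ≡ l + q * (s + t * r)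
    regroup = solve-∀

  decX : ∀ K → ℕ → X K
  decX zero    n = tt
  decX (suc K) n = decX K (n / 4 / 4) , (n / 4) mod 4 , n mod 4

  decX-encX : ∀ {K} (x : X K) → decX K (encX x) ≡ x
  decX-encX {zero}  _ = refl
  decX-encX {suc K} (u , a″ , a′) = cong₂ _,_
    (trans (cong (λ z → decX K (z / 4)) quot′) (trans (cong (decX K) (quot (encX u) a″)) (decX-encX u)))
    (cong₂ _,_ (trans (cong (_mod 4) quot′) (rem (encX u) a″)) (rem (encX u ℕ.* 4 ℕ.+ toℕ a″) a′))
    where
    quot : ∀ m (a : Digit) → (m ℕ.* 4 ℕ.+ toℕ a) / 4 ≡ m
    quot m a = trans (+-distrib-/-∣ˡ (toℕ a) (n∣m*n m))
      (trans (cong₂ ℕ._+_ (m*n/n≡m m 4) (m<n⇒m/n≡0 (toℕ<n a))) (ℕP.+-identityʳ m))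
    rem : ∀ m (a : Digit) → (m ℕ.* 4 ℕ.+ toℕ a) mod 4 ≡ a
    rem m a = toℕ-injective (trans (toℕ-fromℕ< _)
      (trans (cong (_% 4) (ℕP.+-comm (m ℕ.* 4) (toℕ a)))
          (trans ([m+kn]%n≡m%n (toℕ a) m 4) (m<n⇒m%n≡m (toℕ<n a)))))
    quot′ = quot (encX u ℕ.* 4 ℕ.+ toℕ a″) a′

  -- The grid

  -- One point in each column fixes the cardinality and turns double sums over the grid into single
  -- sums.
  graph : ∀ {n} → (Fin n → Fin n) → PointSet n
  graph r (i , j) = does (r i ≟ j)

  sumℕ-select : ∀ n (r : Fin n) → sumℕ n (λ j → if does (r ≟ j) then 1 else 0) ≡ 1
  sumℕ-select (suc n) zero    = cong suc (zeros n)
    where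
    zeros : ∀ n → sumℕ n (λ _ → 0) ≡ 0
    zeros zero    = refl
    zeros (suc n) = zeros n
  sumℕ-select (suc n) (suc r) = sumℕ-select n r

  sumℕ-ones : ∀ n {f : Fin n → ℕ} → (∀ i → f i ≡ 1) → sumℕ n f ≡ n
  sumℕ-ones zero    e = refl
  sumℕ-ones (suc n) e = cong₂ ℕ._+_ (e zero) (sumℕ-ones n (e ∘ suc))

  card-graph : ∀ {n} (r : Fin n → Fin n) → card (graph r) ≡ n
  card-graph {n} r = sumℕ-ones n (λ i → sumℕ-select n (r i))

  sumℤ-cong : ∀ n {f g : Fin n → ℤ} → (∀ i → f i ≡ g i) → sumℤ n f ≡ sumℤ n g
  sumℤ-cong zero    e = refl
  sumℤ-cong (suc n) e = cong₂ _+_ (e zero) (sumℤ-cong n (e ∘ suc))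

  sumℤ-zero : ∀ n → sumℤ n (λ _ → 0ℤ) ≡ 0ℤ
  sumℤ-zero zero    = refl
  sumℤ-zero (suc n) = trans (+-identityˡ _) (sumℤ-zero n)

  sumℤ-+ : ∀ n (f g : Fin n → ℤ) → sumℤ n (λ i → f i + g i) ≡ sumℤ n f + sumℤ n g
  sumℤ-+ zero    f g = refl
  sumℤ-+ (suc n) f g = trans (cong (_+_ (f zero + g zero)) (sumℤ-+ n (f ∘ suc) (g ∘ suc)))
    (interchange (f zero) (g zero) _ _)

  sumℤ-select : ∀ n (r : Fin n) (b : Fin n → Bool) (c : Fin n → ℤ) →
    sumℤ n (λ j → if does (r ≟ j) ∧ b j then c j else 0ℤ) ≡ (if b r then c r else 0ℤ)
  sumℤ-select (suc n) zero    b c = trans (cong (_+_ (if b zero then c zero else 0ℤ)) (sumℤ-zero n))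
      (+-identityʳ _)
  sumℤ-select (suc n) (suc r) b c = trans (+-identityˡ _) (sumℤ-select n r (b ∘ suc) (c ∘ suc))

  -- The default 0 past `n` turns a sum over `Fin n` into one over natural numbers, which can be cut
  -- at `16 ^ K`.
  extend : ∀ n → (Fin n → ℤ) → ℕ → ℤ
  extend zero    f i       = 0ℤ
  extend (suc n) f zero    = f zero
  extend (suc n) f (suc i) = extend n (f ∘ suc) i

  sumℤ-extend : ∀ n f → sumℤ n f ≡ ∑< n (extend n f)
  sumℤ-extend zero    f = refl
  sumℤ-extend (suc n) f = cong (_+_ (f zero)) (sumℤ-extend n (f ∘ suc))

  extend-fromℕ< : ∀ n f {i} (i<n : i ℕ.< n) → extend n f i ≡ f (fromℕ< i<n)
  extend-fromℕ< (suc n) f {zero}  i<n = refl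
  extend-fromℕ< (suc n) f {suc i} i<n = extend-fromℕ< n (f ∘ suc) (ℕ.s<s⁻¹ i<n)

  extend-zero : ∀ n f i → (∀ j → toℕ j ≡ i → f j ≡ 0ℤ) → extend n f i ≡ 0ℤ
  extend-zero zero    f i       e = refl
  extend-zero (suc n) f zero    e = e zero refl
  extend-zero (suc n) f (suc i) e = extend-zero n (f ∘ suc) i (λ j p → e (suc j) (cong suc p))

  ∑<-zero : ∀ n {f : ℕ → ℤ} → (∀ i → f i ≡ 0ℤ) → ∑< n f ≡ 0ℤ
  ∑<-zero zero    e = refl
  ∑<-zero (suc n) e = cong₂ _+_ (e 0) (∑<-zero n (e ∘ suc))

  module Embedding {K n : ℕ} (16^K≤n : 16 ℕ.^ K ℕ.≤ n) where

    finX : X K → Fin n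
    finX x = fromℕ< (ℕP.<-≤-trans (encX-bound x) 16^K≤n)

    finY : Y K → Fin n
    finY y = fromℕ< (ℕP.<-≤-trans (encY-bound y) 16^K≤n)

    row : Tree K → Fin n → Fin n
    row t i with toℕ i ℕP.<? 16 ℕ.^ K
    -- The corners used below reach only columns of this case, so the diagonal points of the other
    -- case add nothing to their sums.
    ... | yes _ = finY (net t (decX K (toℕ i)))
    ... | no  _ = i

    toℕ-finX : ∀ x → toℕ (finX x) ≡ encX x
    toℕ-finX x = toℕ-fromℕ< _

    toℕ-finY : ∀ y → toℕ (finY y) ≡ encY y
    toℕ-finY y = toℕ-fromℕ< _

    row-finX : ∀ t x → row t (finX x) ≡ finY (net t x)
    row-finX t x with toℕ (finX x) ℕP.<? 16 ℕ.^ K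
    ... | yes _ = cong (finY ∘ net t) (trans (cong (decX K) (toℕ-finX x)) (decX-encX x))
    ... | no  ≮ = contradiction (subst (ℕ._< 16 ℕ.^ K) (sym (toℕ-finX x)) (encX-bound x)) ≮

    sumℤ-finX : ∀ f → (∀ i → 16 ℕ.^ K ℕ.≤ toℕ i → f i ≡ 0ℤ) → sumℤ n f ≡ ∑ (allX K) (f ∘ finX)
    sumℤ-finX f outside = begin
      sumℤ n f                                   ≡⟨ sumℤ-extend n f ⟩
      ∑< n g                                     ≡⟨ cong (λ m → ∑< m g) (sym (ℕP.m+[n∸m]≡n 16^K≤n)) ⟩
      ∑< (16 ℕ.^ K ℕ.+ (n ℕ.∸ 16 ℕ.^ K)) g       ≡⟨ ∑<-+ (16 ℕ.^ K) (n ℕ.∸ 16 ℕ.^ K) g ⟩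
      _ ≡⟨ cong (_+_ (∑< (16 ℕ.^ K) g)) (∑<-zero (n ℕ.∸ 16 ℕ.^ K) (λ i → extend-zero n f (16 ℕ.^ K ℕ.+ i)
             (λ j e → outside j (subst (16 ℕ.^ K ℕ.≤_) (sym e) (ℕP.m≤m+n (16 ℕ.^ K) i))))) ⟩
      ∑< (16 ℕ.^ K) g + 0ℤ                       ≡⟨ +-identityʳ _ ⟩
      ∑< (16 ℕ.^ K) g                            ≡⟨ sym (∑-encX K g) ⟩
      ∑ (allX K) (g ∘ encX)                      ≡⟨ ∑-cong (allX K)
          (λ x → extend-fromℕ< n f (ℕP.<-≤-trans (encX-bound x) 16^K≤n)) ⟩
      ∑ (allX K) (f ∘ finX)                      ∎
      where
      open ≡-Reasoning
      g = extend n f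

    origin : Fin n
    origin = fromℕ< (ℕP.<-≤-trans (ℕP.m^n>0 16 K) 16^K≤n)

    corner : X K → Y K → Rect n
    corner x y = rect origin (finX x) origin (finY y)

    -- Both lower bounds hold automatically, since `origin` is 0.
    inCorner : ∀ x y i j → inRect (corner x y) (i , j) ≡ (toℕ i ℕ.≤ᵇ encX x) ∧ (toℕ j ℕ.≤ᵇ encY y)
    inCorner x y i j rewrite isYes≗does (toℕ origin ℕP.≤? toℕ i) | isYes≗does (toℕ i ℕP.≤? toℕ (finX x))
      | isYes≗does (toℕ origin ℕP.≤? toℕ j) | isYes≗does (toℕ j ℕP.≤? toℕ (finY y))
      | toℕ-finX x | toℕ-finY y | toℕ-fromℕ< (ℕP.<-≤-trans (ℕP.m^n>0 16 K) 16^K≤n) = refl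

    signs : Tree K → Coloring n → Signs K
    signs t χ p = χ (finX p , row t (finX p))

    columnSum : ∀ t χ x y → sumℤ n (λ i → sumℤ n (λ j → contrib (graph (row t)) χ (corner x y) (i , j)))
      ≡ cornerSum t (signs t χ) x y
    columnSum t χ x y = begin
      _ ≡⟨ sumℤ-cong n (λ i → sumℤ-select n (row t i) (λ j → inRect (corner x y) (i , j))
          (λ j → colorVal (χ (i , j)))) ⟩
      sumℤ n f ≡⟨ sumℤ-finX f outside ⟩
      ∑ (allX K) (f ∘ finX) ≡⟨ ∑-cong (allX K) inside ⟩
      _ ∎
      where
      open ≡-Reasoning
      f : Fin n → ℤ
      f i = if inRect (corner x y) (i , row t i) then colorVal (χ (i , row t i)) else 0ℤ
      outside : ∀ i → 16 ℕ.^ K ℕ.≤ toℕ i → f i ≡ 0ℤ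
      outside i ≤i rewrite inCorner x y i (row t i)
        | dec-false (toℕ i ℕP.≤? encX x) (λ i≤x → ℕP.<⇒≱ (encX-bound x) (ℕP.≤-trans ≤i i≤x)) = refl
      indicators : ∀ b c v → (if b ∧ c then v else 0ℤ) ≡ v * (ind b * ind c)
      indicators true  true  v = sym (*-identityʳ v)
      indicators true  false v = sym (*-zeroʳ v)
      indicators false c     v = sym (*-zeroʳ v)
      inside : ∀ p → f (finX p) ≡ colorVal (signs t χ p) * (leX p x * leY (net t p) y)
      inside p = begin
        f (finX p)
          ≡⟨ cong (λ b → if b then v else 0ℤ) (inCorner x y (finX p) (row t (finX p))) ⟩
        (if (toℕ (finX p) ℕ.≤ᵇ encX x) ∧ (toℕ (row t (finX p)) ℕ.≤ᵇ encY y) then v else 0ℤ)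
          ≡⟨ indicators (toℕ (finX p) ℕ.≤ᵇ encX x) (toℕ (row t (finX p)) ℕ.≤ᵇ encY y) v ⟩
        v * (le (toℕ (finX p)) (encX x) * le (toℕ (row t (finX p))) (encY y))
          ≡⟨ cong (v *_) (cong₂ _*_ (trans (cong (λ z → le z (encX x)) (toℕ-finX p)) (sym (leX-encX p x)))
               (trans (cong (λ z → le z (encY y)) (trans (cong toℕ (row-finX t p)) (toℕ-finY (net t p))))
                   (sym (leY-encY (net t p) y)))) ⟩
        _ ∎
        where v = colorVal (signs t χ p)

    unionSum-corner : ∀ t₁ t₂ χ₁ χ₂ x y →
      unionSum (graph (row t₁)) (graph (row t₂)) χ₁ χ₂ (corner x y)
        ≡ cornerSum t₁ (signs t₁ χ₁) x y + cornerSum t₂ (signs t₂ χ₂) x y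
    unionSum-corner t₁ t₂ χ₁ χ₂ x y = begin
      _ ≡⟨ sumℤ-cong n (λ i → sumℤ-+ n (λ j → contrib (graph (row t₁)) χ₁ (corner x y) (i , j))
                                       (λ j → contrib (graph (row t₂)) χ₂ (corner x y) (i , j))) ⟩
      _ ≡⟨ sumℤ-+ n (λ i → sumℤ n (λ j → contrib (graph (row t₁)) χ₁ (corner x y) (i , j)))
                    (λ i → sumℤ n (λ j → contrib (graph (row t₂)) χ₂ (corner x y) (i , j))) ⟩
      _ ≡⟨ cong₂ _+_ (columnSum t₁ χ₁ x y) (columnSum t₂ χ₂ x y) ⟩
      _ ∎
      where open ≡-Reasoning

  -- Discrepancy of a pair of point sets

  ∣i∣≤n⇒i≤n : ∀ i {n} → ∣ i ∣ ℕ.≤ n → i ≤ + n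
  ∣i∣≤n⇒i≤n (+ m)    m≤n = +≤+ m≤n
  ∣i∣≤n⇒i≤n -[1+ m ] _   = -≤+

  ∣i∣≤n⇒-n≤i : ∀ i {n} → ∣ i ∣ ℕ.≤ n → - + n ≤ i
  ∣i∣≤n⇒-n≤i (+ m)    {zero}  _   = +≤+ ℕ.z≤n
  ∣i∣≤n⇒-n≤i (+ m)    {suc n} _   = -≤+
  ∣i∣≤n⇒-n≤i -[1+ m ] {suc n} m≤n = -≤- (ℕ.s≤s⁻¹ m≤n)

  module _ {K n : ℕ} (16^K≤n : 16 ℕ.^ K ℕ.≤ n) where
    open Embedding {K} {n} 16^K≤n

    -- If every corner failed, the colour sums would be at most `k / b` in absolute value, and
    -- `treeDist-bound` would cap the Hamming distance by `32 * (k / b) * 16 ^ K`, which is too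
    -- small.
    disc-lower-bound : ∀ (b : ℕ) .⦃ _ : NonZero b ⦄ (k M : ℕ) β γ →
      M ℕ.< hamming (bitCount K) β γ → 32 ℕ.* k ℕ.* 16 ℕ.^ K ℕ.≤ b ℕ.* M →
      DiscUnionAtLeast (graph (row (tree K β))) (graph (row (tree K γ))) 1 b k
    disc-lower-bound b k M β γ M<H small χ₁ χ₂
      -- A finite search over the upper right vertices of rectangles anchored at the origin makes
      -- the case distinction decidable and supplies the rectangle.
      with any? (λ X′ → any?
          (λ Y′ → 1 ℕ.* k ℕP.≤? b ℕ.* ∣ unionSum (graph (row (tree K β))) (graph (row (tree K γ))) χ₁ χ₂
              (rect origin X′ origin Y′) ∣))
    ... | yes (X′ , Y′ , large) = rect origin X′ origin Y′ , large
    ... | no  none = contradiction (begin-strict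
        b ℕ.* M                            <⟨ ℕP.*-monoʳ-< b M<H ⟩
        b ℕ.* H                            ≤⟨ ℕP.*-monoʳ-≤ b H-bound ⟩
        b ℕ.* (32 ℕ.* (k / b) ℕ.* 16 ℕ.^ K) ≡⟨ regroup b (k / b) (16 ℕ.^ K) ⟩
        32 ℕ.* (k / b ℕ.* b) ℕ.* 16 ℕ.^ K  ≤⟨ ℕP.*-monoˡ-≤ (16 ℕ.^ K) (ℕP.*-monoʳ-≤ 32 (m/n*n≤m k b)) ⟩
        32 ℕ.* k ℕ.* 16 ℕ.^ K              ≤⟨ small ⟩
        b ℕ.* M                            ∎) (ℕP.<-irrefl refl)
      where
      open ℕP.≤-Reasoning
      H = hamming (bitCount K) β γ
      D : X K → Y K → ℤ
      D x y = cornerSum (tree K β) (signs (tree K β) χ₁) x y + cornerSum (tree K γ) (signs (tree K γ) χ₂) x y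
      D-bound : ∀ x y → ∣ D x y ∣ ℕ.≤ k / b
      D-bound x y = begin
        ∣ D x y ∣                 ≡⟨ sym (m*n/n≡m ∣ D x y ∣ b) ⟩
        ∣ D x y ∣ ℕ.* b / b       ≤⟨ /-monoˡ-≤ b (begin
          ∣ D x y ∣ ℕ.* b         ≡⟨ ℕP.*-comm ∣ D x y ∣ b ⟩
          b ℕ.* ∣ D x y ∣         ≡⟨ cong (λ z → b ℕ.* ∣ z ∣)
              (sym (unionSum-corner (tree K β) (tree K γ) χ₁ χ₂ x y)) ⟩
          _                       ≤⟨ ℕP.<⇒≤ (ℕP.≰⇒> (λ large → none (finX x , finY y , large))) ⟩
          1 ℕ.* k                 ≡⟨ ℕP.*-identityˡ k ⟩
          k                       ∎) ⟩
        k / b                     ∎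
      H-bound : H ℕ.≤ 32 ℕ.* (k / b) ℕ.* 16 ℕ.^ K
      H-bound = drop‿+≤+ (subst₂ _≤_ (treeDist-hamming K β γ)
        (trans (cong₂ _*_ (sym (pos-* 32 (k / b))) (pw-pos K)) (sym (pos-* (32 ℕ.* (k / b)) (16 ℕ.^ K))))
        (treeDist-bound K (tree K β) (tree K γ) (signs (tree K β) χ₁) (signs (tree K γ) χ₂) (+ (k / b))
          (λ x y → ∣i∣≤n⇒i≤n (D x y) (D-bound x y)) (λ x y → ∣i∣≤n⇒-n≤i (D x y) (D-bound x y))))
      regroup : ∀ b q P → b ℕ.* (32 ℕ.* q ℕ.* P) ≡ 32 ℕ.* (q ℕ.* b) ℕ.* P
      regroup = ℕSolver.solve-∀

  -- Opposite colours on the two copies of a point cancel.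
  disc⇒distinct : ∀ {n} (P Q : PointSet n) b k → 1 ℕ.≤ k → DiscUnionAtLeast P Q 1 b k → ¬ (∀ p → P p ≡ Q p)
  disc⇒distinct {n} P Q b k 1≤k disc P≗Q with disc (λ _ → true) (λ _ → false)
  ... | R , large = contradiction (begin-strict
      0           <⟨ 1≤k ⟩
      k           ≡⟨ sym (ℕP.*-identityˡ k) ⟩
      1 ℕ.* k     ≤⟨ large ⟩
      b ℕ.* ∣ unionSum P Q (λ _ → true) (λ _ → false) R ∣ ≡⟨ cong (λ z → b ℕ.* ∣ z ∣) balanced ⟩
      b ℕ.* 0     ≡⟨ ℕP.*-zeroʳ b ⟩
      0           ∎) (ℕP.<-irrefl refl)
    where
    open ℕP.≤-Reasoning
    cancel : ∀ p → contrib P (λ _ → true) R p + contrib Q (λ _ → false) R p ≡ 0ℤ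
    cancel p rewrite P≗Q p with Q p ∧ inRect R p
    ... | true  = refl
    ... | false = refl
    balanced : unionSum P Q (λ _ → true) (λ _ → false) R ≡ 0ℤ
    balanced = trans (sumℤ-cong n (λ i → trans (sumℤ-cong n (λ j → cancel (i , j))) (sumℤ-zero n)))
        (sumℤ-zero n)

  -- Choice of parameters and constants

  bitCount-16 : ∀ K → bitCount (suc (suc K)) ≡ 16 ℕ.* (suc (suc K) ℕ.* 16 ℕ.^ K)
  bitCount-16 K = ℕP.*-cancelˡ-≡ _ _ 16
      (trans (bitCount-closed (suc (suc K))) (regroup (suc (suc K)) (16 ℕ.^ K)))
    where
    regroup : ∀ L P → L ℕ.* (16 ℕ.* (16 ℕ.* P)) ≡ 16 ℕ.* (16 ℕ.* (L ℕ.* P))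
    regroup = ℕSolver.solve-∀

  -- The constants are variables tied by an equation, so that the ring solver works with symbols
  -- instead of large numerals.
  disc-arith : ∀ c d e {b} → c ℕ.* d ℕ.* e ℕ.* e ≡ b → ∀ {k} L P → k ℕ.≤ d ℕ.* L →
    c ℕ.* k ℕ.* (e ℕ.* (e ℕ.* P)) ℕ.≤ b ℕ.* (L ℕ.* P)
  disc-arith c d e refl {k} L P k≤dL = begin
    c ℕ.* k ℕ.* (e ℕ.* (e ℕ.* P))         ≤⟨ ℕP.*-monoˡ-≤ (e ℕ.* (e ℕ.* P)) (ℕP.*-monoʳ-≤ c k≤dL) ⟩
    c ℕ.* (d ℕ.* L) ℕ.* (e ℕ.* (e ℕ.* P)) ≡⟨ regroup c d e L P ⟩
    _                                     ∎
    where
    open ℕP.≤-Reasoning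
    regroup : ∀ c d e L P → c ℕ.* (d ℕ.* L) ℕ.* (e ℕ.* (e ℕ.* P)) ≡ c ℕ.* d ℕ.* e ℕ.* e ℕ.* (L ℕ.* P)
    regroup = ℕSolver.solve-∀

  rate-arith : ∀ d e {b″} → d ℕ.* d ℕ.* e ℕ.* e ≡ b″ → ∀ {n k} L P →
    n ℕ.≤ d ℕ.* (e ℕ.* (e ℕ.* P)) → k ℕ.≤ d ℕ.* L → n ℕ.* k ℕ.≤ L ℕ.* P ℕ.* b″
  rate-arith d e refl {n} {k} L P n≤ k≤ = begin
    n ℕ.* k                               ≤⟨ ℕP.*-mono-≤ n≤ k≤ ⟩
    d ℕ.* (e ℕ.* (e ℕ.* P)) ℕ.* (d ℕ.* L) ≡⟨ regroup d e L P ⟩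
    _                                     ∎
    where
    open ℕP.≤-Reasoning
    regroup : ∀ d e L P → d ℕ.* (e ℕ.* (e ℕ.* P)) ℕ.* (d ℕ.* L) ≡ L ℕ.* P ℕ.* (d ℕ.* d ℕ.* e ℕ.* e)
    regroup = ℕSolver.solve-∀

  -- The conclusion of the theorem for n = `2 ^ k`, with both numerators set to 1.
  Family : (b b″ k : ℕ) → Set
  Family b b″ k = ∃ λ (m : ℕ) → Σ (Fin m → PointSet (2 ℕ.^ k)) λ Q →
      ((i : Fin m) → card (Q i) ≡ 2 ℕ.^ k) ×
      ((i j : Fin m) → i ≢ j → ¬ ((p : Point (2 ℕ.^ k)) → Q i p ≡ Q j p)) ×
      2 ℕ.^ (1 ℕ.* 2 ℕ.^ k ℕ.* k) ℕ.≤ m ℕ.^ b″ ×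
      ((i j : Fin m) → i ≢ j → DiscUnionAtLeast (Q i) (Q j) 1 b k)

  -- In the products below 32 is the constant of treeDist-bound, 8 bounds both k / K
  -- and 2^k / 16^K, and 16 · 16 = 16^K / P.
  family : ∀ b b″ .⦃ _ : NonZero b ⦄ → 32 ℕ.* 8 ℕ.* 16 ℕ.* 16 ≡ b → 8 ℕ.* 8 ℕ.* 16 ℕ.* 16 ≡ b″ →
    ∀ k K P r → bitCount K ≡ 16 ℕ.* (K ℕ.* P) → 16 ℕ.^ K ≡ 16 ℕ.* (16 ℕ.* P) →
    1 ℕ.≤ K → k ≡ r ℕ.+ K ℕ.* 4 → r ℕ.< 4 → Family b b″ k
  family b b″ b≡ b″≡ k K P r bits≡ 16^K≡ 1≤K k≡ r<4 = build (code-exists (K ℕ.* P))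
    where
    open ℕP.≤-Reasoning
    M = K ℕ.* P
    16^≡2^ : 16 ℕ.^ K ≡ 2 ℕ.^ (K ℕ.* 4)
    16^≡2^ = trans (ℕP.^-*-assoc 2 4 K) (cong (2 ℕ.^_) (ℕP.*-comm 4 K))
    fits : 16 ℕ.^ K ℕ.≤ 2 ℕ.^ k
    fits = begin
      16 ℕ.^ K        ≡⟨ 16^≡2^ ⟩
      2 ℕ.^ (K ℕ.* 4) ≤⟨ ℕP.^-monoʳ-≤ 2 (ℕP.≤-trans (ℕP.m≤n+m (K ℕ.* 4) r) (ℕP.≤-reflexive (sym k≡))) ⟩
      2 ℕ.^ k         ∎
    open Embedding {K} {2 ℕ.^ k} fits
    r≤3 : r ℕ.≤ 3
    r≤3 = ℕ.s≤s⁻¹ r<4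
    4≤k : 1 ℕ.* 4 ℕ.≤ k
    4≤k = begin
      1 ℕ.* 4       ≤⟨ ℕP.*-monoˡ-≤ 4 1≤K ⟩
      K ℕ.* 4       ≤⟨ ℕP.m≤n+m (K ℕ.* 4) r ⟩
      r ℕ.+ K ℕ.* 4 ≡⟨ sym k≡ ⟩
      k             ∎
    k≤8K : k ℕ.≤ 8 ℕ.* K
    k≤8K = begin
      k                     ≡⟨ k≡ ⟩
      r ℕ.+ K ℕ.* 4         ≤⟨ ℕP.+-monoˡ-≤ (K ℕ.* 4) (ℕP.≤-trans (ℕP.<⇒≤ r<4) (ℕP.*-monoˡ-≤ 4 1≤K)) ⟩
      K ℕ.* 4 ℕ.+ K ℕ.* 4   ≡⟨ double K ⟩
      8 ℕ.* K               ∎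
      where
      double : ∀ K → K ℕ.* 4 ℕ.+ K ℕ.* 4 ≡ 8 ℕ.* K
      double = ℕSolver.solve-∀
    2^k≤ : 2 ℕ.^ k ℕ.≤ 8 ℕ.* (16 ℕ.* (16 ℕ.* P))
    2^k≤ = begin
      2 ℕ.^ k                     ≡⟨ cong (2 ℕ.^_) k≡ ⟩
      2 ℕ.^ (r ℕ.+ K ℕ.* 4)       ≡⟨ ℕP.^-distribˡ-+-* 2 r (K ℕ.* 4) ⟩
      2 ℕ.^ r ℕ.* 2 ℕ.^ (K ℕ.* 4) ≤⟨ ℕP.*-monoˡ-≤ (2 ℕ.^ (K ℕ.* 4)) (ℕP.^-monoʳ-≤ 2 r≤3) ⟩
      8 ℕ.* 2 ℕ.^ (K ℕ.* 4)       ≡⟨ cong (8 ℕ.*_) (trans (sym 16^≡2^) 16^K≡) ⟩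
      8 ℕ.* (16 ℕ.* (16 ℕ.* P))   ∎
    build : (∃ λ (ys : List Bits) →
        (∀ i j → i ≢ j → M ℕ.< hamming (16 ℕ.* M) (lookup ys i) (lookup ys j)) ×
        2 ℕ.^ (10 ℕ.* M) ℕ.≤ length ys) → Family b b″ k
    build (ys , far , many) = length ys , Q , (λ i → card-graph (row (tree K (lookup ys i)))) ,
      (λ i j i≢j → disc⇒distinct (Q i) (Q j) b k (ℕP.≤-trans (ℕ.s≤s ℕ.z≤n) 4≤k)
          (disc i j i≢j)) , entropy , disc
      where
      Q : Fin (length ys) → PointSet (2 ℕ.^ k)
      Q i = graph (row (tree K (lookup ys i)))
      disc : ∀ i j → i ≢ j → DiscUnionAtLeast (Q i) (Q j) 1 b k
      disc i j i≢j = disc-lower-bound {K} {2 ℕ.^ k} fits b k M (lookup ys i) (lookup ys j)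
        (subst (λ N → M ℕ.< hamming N (lookup ys i) (lookup ys j)) (sym bits≡) (far i j i≢j))
        (subst (λ N → 32 ℕ.* k ℕ.* N ℕ.≤ b ℕ.* M) (sym 16^K≡) (disc-arith 32 8 16 b≡ K P k≤8K))
      entropy : 2 ℕ.^ (1 ℕ.* 2 ℕ.^ k ℕ.* k) ℕ.≤ length ys ℕ.^ b″
      entropy = begin
        2 ℕ.^ (1 ℕ.* 2 ℕ.^ k ℕ.* k) ≤⟨ ℕP.^-monoʳ-≤ 2 (begin
          1 ℕ.* 2 ℕ.^ k ℕ.* k       ≡⟨ cong (ℕ._* k) (ℕP.*-identityˡ (2 ℕ.^ k)) ⟩
          2 ℕ.^ k ℕ.* k             ≤⟨ rate-arith 8 16 b″≡ K P 2^k≤ k≤8K ⟩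
          -- The rate estimate fits into the exponent `M`; the code provides ten times that.
          M ℕ.* b″                  ≤⟨ ℕP.*-monoˡ-≤ b″ (ℕP.m≤m+n M (9 ℕ.* M)) ⟩
          10 ℕ.* M ℕ.* b″           ∎) ⟩
        2 ℕ.^ (10 ℕ.* M ℕ.* b″)     ≡⟨ sym (ℕP.^-*-assoc 2 (10 ℕ.* M) b″) ⟩
        (2 ℕ.^ (10 ℕ.* M)) ℕ.^ b″   ≤⟨ ℕP.^-monoˡ-≤ b″ many ⟩
        length ys ℕ.^ b″            ∎

  family-large : ∀ b b″ .⦃ _ : NonZero b ⦄ → 32 ℕ.* 8 ℕ.* 16 ℕ.* 16 ≡ b → 8 ℕ.* 8 ℕ.* 16 ℕ.* 16 ≡ b″ →
    ∀ k → 2 ℕ.^ 8 ℕ.≤ 2 ℕ.^ k → Family b b″ k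
  family-large b b″ b≡ b″≡ k 2^8≤2^k = split (k / 4) (m≡m%n+[m/n]*n k 4)
    where
    8≤k : 8 ℕ.≤ k
    8≤k = ℕP.≮⇒≥ (λ k<8 → ℕP.<⇒≱ (ℕP.^-monoʳ-< 2 (ℕ.s≤s (ℕ.s≤s ℕ.z≤n)) k<8) 2^8≤2^k)
    small : ∀ {q} → q ℕ.≤ 1 → k ≢ k % 4 ℕ.+ q ℕ.* 4
    small q≤1 e = ℕP.<⇒≱ (ℕP.+-mono-<-≤ (m%n<n k 4) (ℕP.*-monoˡ-≤ 4 q≤1)) (subst (8 ℕ.≤_) e 8≤k)
    split : ∀ q → k ≡ k % 4 ℕ.+ q ℕ.* 4 → Family b b″ k
    split 0             e = contradiction e (small ℕ.z≤n)
    split 1             e = contradiction e (small ℕP.≤-refl)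
    -- With at least two base-16 digits, `P` is 16 to their number minus 2, and the bit count
    -- becomes 16 times `M`, the length of the code.
    split (suc (suc K)) e =
      family b b″ b≡ b″≡ k (suc (suc K)) (16 ℕ.^ K) (k % 4) (bitCount-16 K) refl (ℕ.s≤s ℕ.z≤n) e (m%n<n k 4)

open import Data.Nat using (_+_; _*_; _≤_; _^_)
open Nets using (family-large)

theorem2 : ∃ λ (a : ℕ) → ∃ λ (b : ℕ) → ∃ λ (a'' : ℕ) → ∃ λ (b'' : ℕ) →
    1 ≤ a × 1 ≤ b × 1 ≤ a'' × 1 ≤ b'' ×
    ∃ λ (N : ℕ) → (k : ℕ) → N ≤ 2 ^ k →
    ∃ λ (m : ℕ) → Σ (Fin m → PointSet (2 ^ k)) λ Q →
    ((i : Fin m) → card (Q i) ≡ 2 ^ k) ×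
    ((i j : Fin m) → i ≢ j → ¬ ((p : Point (2 ^ k)) → Q i p ≡ Q j p)) ×
    2 ^ (a'' * 2 ^ k * k) ≤ m ^ b'' ×
    ((i j : Fin m) → i ≢ j → DiscUnionAtLeast (Q i) (Q j) a b k)
-- Thus c is 1 / `2 ^ 16` and c″ is 1 / `2 ^ 14`, for n from `2 ^ 8` on, where k is at least 8 and
-- two base-16 digits are available. Each `refl` evaluates a product of constants required by
-- `family`.
theorem2 = 1 , 2 ^ 16 , 1 , 2 ^ 14 ,
  ℕP.≤-refl , ℕP.m^n>0 2 16 , ℕP.≤-refl , ℕP.m^n>0 2 14 , 2 ^ 8 , family-large (2 ^ 16) (2 ^ 14) refl refl
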